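{- Let $S \subseteq \mathbb{Z}$ with $|S| = 4$. Then $p_{\mathbb{Z}}(S) \ge 3$; that is, there is a coloring of $\mathbb{Z}$ with $3$ colors such that every translate $n+S$, $n \in \mathbb{Z}$, contains an element of each of the three colors.
   Context: For an abelian group $G$, $S \subseteq G$ and $n \in G$, the set $n+S=\{n+s : s\in S\}$ is a translate of $S$. A coloring of the elements of $G$ is $S$-polychromatic if every translate of $S$ contains an element of each color. The polychromatic number $p_G(S)$ (written $p(S)$ when $G$ is clear) is the largest number of colors for which an $S$-polychromatic coloring of $G$ exists. -}

module Defs where

open import Algebra.Bundles using (AbelianGroup)
open import Data.Fin using (Fin)
open import Data.Nat using (ℕ; _≤_)
open import Data.Product using (_×_; ∃-syntax; Σ-syntax)
open import Function.Bundles using (Func; _⇔_)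
open import Function.Definitions using (Injective)
open import Level using (Level; _⊔_)
open import Relation.Binary.PropositionalEquality using (_≡_; setoid)
open import Relation.Unary using (Pred; _∈_)

HasCardinality : ∀ {a ℓ} {A : Set a} → Pred A ℓ → ℕ → Set (a ⊔ ℓ)
HasCardinality {A = A} S n =
  Σ[ f ∈ (Fin n → A) ] Injective _≡_ _≡_ f × (∀ x → x ∈ S ⇔ (∃[ i ] f i ≡ x))

module Polychromatic {c e : Level} (G : AbelianGroup c e) where
  open AbelianGroup G using (Carrier; _≈_; _∙_) renaming (setoid to setoidᴳ)

  translate : ∀ {ℓ} → Carrier → Pred Carrier ℓ → Pred Carrier (c ⊔ e ⊔ ℓ)
  translate n S x = ∃[ s ] s ∈ S × x ≈ n ∙ s

  -- The Func bundle makes a coloring respect the group's equality _≈_.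
  Coloring : ℕ → Set (c ⊔ e)
  Coloring k = Func setoidᴳ (setoid (Fin k))

  IsPolychromatic : ∀ {ℓ k} → Pred Carrier ℓ → Coloring k → Set (c ⊔ e ⊔ ℓ)
  IsPolychromatic {k = k} S χ =
    ∀ (n : Carrier) (color : Fin k) → ∃[ x ] x ∈ translate n S × Func.to χ x ≡ color

  HasPolychromaticColoring : ∀ {ℓ} → Pred Carrier ℓ → ℕ → Set (c ⊔ e ⊔ ℓ)
  HasPolychromaticColoring S k = ∃[ χ ] IsPolychromatic {k = k} S χ

  -- p_G(S) = p, as a relation: a maximum need not be computable from S.
  IsPolychromaticNumber : ∀ {ℓ} → Pred Carrier ℓ → ℕ → Set (c ⊔ e ⊔ ℓ)
  IsPolychromaticNumber S p =
    HasPolychromaticColoring S p × (∀ k → HasPolychromaticColoring S k → k ≤ p)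

{-# OPTIONS --safe #-}
module Submission where

-- S = {0, a, b, c} with 0 < a < b < c and gcd 1 becomes {0, b} + {0, c} modulo
-- m = b + c − a, so it suffices to find an m-periodic colouring for such a sum.
-- If, for some j, the multiples by j of four integers leave no gap longer than
-- m / 3 on the circle ℤ / m, then colouring n by the third of the circle that
-- contains j n is polychromatic.  For {0, x} + {0, y} the condition says that
-- (j x, j y) lies in one of a few triangles of the torus (ℤ / m)².  When m > 225,
-- Dirichlet's theorem yields a multiple (p, q) of (x, y) with |p|, |q| ≤ m / 15,
-- and its multiples, shifted by a multiple of (x, y) if the line they follow is
-- parallel to an axis or to a diagonal, walk into a triangle, unless
-- 2 (x ± y) ≡ 0.  In that exceptional case the set is {0, 1, h − 1, h} modulo
-- 2 h up to a unit, and an explicit word colours it.  For 36 ≤ m ≤ 225 a finite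
-- check runs through all lattices generated by (x, y) modulo m, and for m ≤ 35
-- through all (a, b, c), where circles of other lengths are used as well.

-- The constants 15 and 225 = 15² come from the walks parallel to an axis. One triangle has the
-- corners (m / 6, m / 2), (m / 3, m / 3), (m / 3, 2 m / 3); exchanging x and y and changing signs
-- gives the other three. If x has order 5 modulo m, a walk along the y-axis can be shifted only to
-- the lines X = ± m / 5 and ± 2 m / 5 besides the axis itself, and these meet the triangles in
-- segments of length m / 15. Steps of at most m / 15 suffice even in this tightest case, and 15 ×
-- 15 boxes provide them.
--
-- The exceptional case is a real obstacle: if 2 (x - y) ≡ 0, all multiples of (x, y) lie on the
-- lines Y = X and Y = X + m / 2, which meet the triangles at most in the corners (m / 3, m / 3) and
-- (2 m / 3, 2 m / 3).
--
-- For small m the period m itself can fail. For {0, 4, 5, 7} it is 8: one of three colours would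
-- occupy at most two residues, but the set does not tile ℤ / 8. Hence the circles of other lengths.

open import Data.Bool using (Bool; true; false; _∧_; _∨_; T)
open import Data.Fin as Fin using (Fin; toℕ; fromℕ<)
open import Data.Fin.Patterns using (0F; 1F; 2F)
import Data.Fin.Properties as Fin
open import Data.Integer as ℤ using (ℤ; +_; -[1+_]; _+_; _*_; _-_; -_; 0ℤ; 1ℤ; +≤+; +<+; _%ℕ_; _/ℕ_)
open import Data.Integer.DivMod using (a≡a%ℕn+[a/ℕn]*n; n%ℕd<d)
import Data.Integer.Properties as ℤ
open import Data.Integer.Properties using (+-0-abelianGroup)
open import Data.Integer.Tactic.RingSolver using (solve-∀)
open import Data.List using (List; []; _∷_; map; length; tabulate)
open import Data.List.Relation.Binary.Permutation.Propositional using (_↭_; prep; swap; ↭-refl; ↭-sym; ↭⇒↭ₛ)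
open import Data.List.Relation.Binary.Permutation.Propositional.Properties using (Any-resp-↭; ↭-length)
open import Data.List.Relation.Binary.Permutation.Setoid.Properties ℤ.≡-setoid using (AllPairs-resp-↭)
open import Data.List.Relation.Unary.All using (_∷_)
open import Data.List.Relation.Unary.AllPairs using (AllPairs; _∷_)
import Data.List.Relation.Unary.AllPairs.Properties as AllPairs
open import Data.List.Relation.Unary.Any as Any using (Any; here; there)
import Data.List.Relation.Unary.Any.Properties as Any
open import Data.List.Relation.Unary.Linked using (Linked; [-]; _∷_)
open import Data.List.Sort ℤ.≤-decTotalOrder using (sort; sort-↭; sort-↗)
open import Data.Nat as ℕ using (ℕ; zero; suc; NonZero; _≤_; _≤ᵇ_; _<ᵇ_; _≡ᵇ_)
open import Data.Nat.Divisibility using (divides; _∣_; ∣-trans)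
import Data.Nat.DivMod as ℕ
open import Data.Nat.GCD using (module Bézout; module GCD)
import Data.Nat.Properties as ℕ
open import Data.Product as Product using (_×_; _,_; ∃-syntax; proj₁; proj₂)
open import Data.Sum using (_⊎_; inj₁; inj₂)
open import Data.Unit using (tt)
open import Data.Vec using (Vec; []; _∷_; lookup)
open import Function using (_∘_)
open import Function.Bundles using (Equivalence)
open import Level using (Level)
open import Relation.Binary.PropositionalEquality using (_≡_; _≢_; refl; sym; trans; cong; cong₂; subst; subst₂)
open import Relation.Nullary using (¬_; contradiction; yes; no; Dec)
open import Relation.Nullary.Decidable using (True; toWitness; _×-dec_)
open import Relation.Unary using (Pred)
open import Defs

-- Inequalities between integers are kept in the form 0 ≤ e, so that a linear
-- combination of hypotheses becomes a goal by one ring identity.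

infix 4 0≤_
0≤_ : ℤ → Set
0≤ e = 0ℤ ℤ.≤ e

infixl 6 _⊕_
_⊕_ : ∀ {d e} → 0≤ d → 0≤ e → 0≤ d + e
_⊕_ = ℤ.+-mono-≤

infixl 7 _⊗_
_⊗_ : ∀ {d e} → 0≤ d → 0≤ e → 0≤ d * e
_⊗_ {+ d} {+ e} _ _ = subst (0ℤ ℤ.≤_) (ℤ.pos-* d e) (+≤+ ℕ.z≤n)

infixl 7 _⊙_
_⊙_ : ∀ c {e} → 0≤ e → 0≤ + c * e
c ⊙ p = +≤+ {n = c} ℕ.z≤n ⊗ p

infixl 3 _by_
_by_ : ∀ {d e} → 0≤ d → d ≡ e → 0≤ e
p by refl = p

0≤+ : ∀ n → 0≤ + n
0≤+ n = +≤+ ℕ.z≤n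

0≤-cancel : ∀ c .{{_ : NonZero c}} {e} → 0≤ + c * e → 0≤ e
0≤-cancel (suc c) {+ e}      _ = +≤+ ℕ.z≤n
0≤-cancel (suc c) { -[1+ e ]} ()

split : ∀ d → 0≤ d ⊎ 0≤ - d - 1ℤ
split (+ n)    = inj₁ (0≤+ n)
split -[1+ n ] = inj₂ (0≤+ n)

absurd-sum : ∀ {d e} → 0≤ d → 0≤ e → d + e ≡ - 1ℤ → ∀ {a} {A : Set a} → A
absurd-sum p q eq = contradiction (subst (0ℤ ℤ.≤_) eq (p ⊕ q)) λ ()

diff : ∀ {d e} → d ℤ.≤ e → 0≤ e - d
diff = ℤ.i≤j⇒0≤j-i

diff< : ∀ {d e} → d ℤ.< e → 0≤ e - d - 1ℤ
diff< {d} {e} p = diff (ℤ.i<j⇒suc[i]≤j p) by eq e d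
  where
  eq : ∀ e d → e - (1ℤ + d) ≡ e - d - 1ℤ
  eq = solve-∀

-- Congruences, quotients and residues

infix 4 _≈_[_]
record _≈_[_] (a b m : ℤ) : Set where
  constructor _,_
  field
    multiple : ℤ
    equation : a ≡ b + multiple * m

≤-antisym-0 : ∀ {a b} → 0≤ b - a → 0≤ a - b → a ≡ b
≤-antisym-0 p q = ℤ.≤-antisym (ℤ.0≤i-j⇒j≤i p) (ℤ.0≤i-j⇒j≤i q)

module _ {m : ℤ} (0≤m : 0≤ m) where

  quotient-≤ : ∀ {z q q′} → 0≤ z - q * m → 0≤ q′ * m + m - z - 1ℤ → 0≤ q′ - q
  quotient-≤ {z} {q} {q′} lo hi with split (q′ - q)
  ... | inj₁ p = p
  ... | inj₂ p = absurd-sum (lo ⊕ hi) (p ⊗ 0≤m) (eq m z q q′)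
    where
    eq : ∀ m z q q′ → z - q * m + (q′ * m + m - z - 1ℤ) + (- (q′ - q) - 1ℤ) * m ≡ - 1ℤ
    eq = solve-∀

  quotient-unique : ∀ {z q q′} → 0≤ z - q * m → 0≤ q * m + m - z - 1ℤ →
                    0≤ z - q′ * m → 0≤ q′ * m + m - z - 1ℤ → q ≡ q′
  quotient-unique {z} {q} {q′} lo hi lo′ hi′ =
    ≤-antisym-0 (quotient-≤ {z} {q} {q′} lo hi′) (quotient-≤ {z} {q′} {q} lo′ hi)

/ℕ-lower : ∀ z m .{{_ : NonZero m}} → 0≤ z - (z /ℕ m) * + m
/ℕ-lower z m = 0≤+ (z %ℕ m) by trans (eq (+ (z %ℕ m)) (z /ℕ m * + m))
  (cong (_- (z /ℕ m * + m)) (sym (a≡a%ℕn+[a/ℕn]*n z m)))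
  where
  eq : ∀ r p → r ≡ r + p - p
  eq = solve-∀

/ℕ-upper : ∀ z m .{{_ : NonZero m}} → 0≤ (z /ℕ m) * + m + + m - z - 1ℤ
/ℕ-upper z m = diff< (+<+ (n%ℕd<d z m)) by trans (eq (+ (z %ℕ m)) (z /ℕ m * + m) (+ m))
  (cong (λ w → z /ℕ m * + m + + m - w - 1ℤ) (sym (a≡a%ℕn+[a/ℕn]*n z m)))
  where
  eq : ∀ r p m → m - r - 1ℤ ≡ p + m - (r + p) - 1ℤ
  eq = solve-∀

/ℕ-unique : ∀ {z q} m .{{_ : NonZero m}} → 0≤ z - q * + m → 0≤ q * + m + + m - z - 1ℤ → z /ℕ m ≡ q
/ℕ-unique {z} {q} m lo hi = quotient-unique (0≤+ m) {z} {z /ℕ m} {q} (/ℕ-lower z m) (/ℕ-upper z m) lo hi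

%ℕ-unique : ∀ {z q} m .{{_ : NonZero m}} r → r ℕ.< m → z ≡ + r + q * + m → z %ℕ m ≡ r
%ℕ-unique {z} {q} m r r<m refl = ℤ.+-injective
  (trans (eq₁ _ _ z%) (trans (cong (λ w → z - w * + m) z/) (sym (eq₁ (+ r) (q * + m) refl))))
  where
  z% : z ≡ + (z %ℕ m) + (z /ℕ m) * + m
  z% = a≡a%ℕn+[a/ℕn]*n z m
  eq₁ : ∀ {z} a b → z ≡ a + b → a ≡ z - b
  eq₁ a b refl = eq a b
    where
    eq : ∀ a b → a ≡ a + b - b
    eq = solve-∀
  eq₂ : ∀ r p → r ≡ r + p - p
  eq₂ = solve-∀
  eq₃ : ∀ r p m → m - r - 1ℤ ≡ p + m - (r + p) - 1ℤ
  eq₃ = solve-∀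
  z/ : z /ℕ m ≡ q
  z/ = /ℕ-unique {z} {q} m (0≤+ r by eq₂ (+ r) (q * + m)) (diff< (+<+ r<m) by eq₃ (+ r) (q * + m) (+ m))

mod3 : ℤ → Fin 3
mod3 z = fromℕ< (n%ℕd<d z 3)

mod3-≡ : ∀ {z} q (k : Fin 3) → z ≡ + toℕ k + q * + 3 → mod3 z ≡ k
mod3-≡ {z} q k eq = Fin.toℕ-injective
  (trans (Fin.toℕ-fromℕ< (n%ℕd<d z 3)) (%ℕ-unique {q = q} 3 (toℕ k) (Fin.toℕ<n k) eq))

mod3-shift : ∀ q k → mod3 (q + k * + 3) ≡ mod3 q
mod3-shift q k = mod3-≡ (q /ℕ 3 + k) (mod3 q) (trans
  (cong (_+ k * + 3) (trans (a≡a%ℕn+[a/ℕn]*n q 3) (cong (λ w → + w + q /ℕ 3 * + 3) (sym (Fin.toℕ-fromℕ< (n%ℕd<d q 3))))))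
  (eq (+ toℕ (mod3 q)) (q /ℕ 3) k))
  where
  eq : ∀ r s k → r + s * + 3 + k * + 3 ≡ r + (s + k) * + 3
  eq = solve-∀

mod3-hit : ∀ q k → ∃[ δ ] δ ℕ.< 3 × mod3 (q + + δ) ≡ k
mod3-hit q k = δ , n%ℕd<d d 3 , mod3-≡ (- (d /ℕ 3)) k
  (trans (eq₁ q (+ δ) (d /ℕ 3))
    (trans (cong (λ w → q + w - d /ℕ 3 * + 3) (sym (a≡a%ℕn+[a/ℕn]*n d 3))) (eq₂ q (+ toℕ k) (d /ℕ 3))))
  where
  d = + toℕ k - q
  δ = d %ℕ 3
  eq₁ : ∀ q δ s → q + δ ≡ q + (δ + s * + 3) - s * + 3
  eq₁ = solve-∀
  eq₂ : ∀ q k s → q + (k - q) - s * + 3 ≡ k + - s * + 3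
  eq₂ = solve-∀

-- Colourings and the arcs of a circle

pattern 1st p = here p
pattern 2nd p = there (here p)
pattern 3rd p = there (there (here p))
pattern 4th p = there (there (there (here p)))

Cover : (ℤ → Fin 3) → List ℤ → Set
Cover χ S = ∀ n k → Any (λ s → χ (n + s) ≡ k) S

Periodic : ℤ → (ℤ → Fin 3) → Set
Periodic m χ = ∀ n k → χ (n + k * m) ≡ χ n

Colourable : List ℤ → Set
Colourable S = ∃[ χ ] Cover χ S

Colourable[_] : ℤ → List ℤ → Set
Colourable[ m ] S = ∃[ χ ] Periodic m χ × Cover χ S

-- Dividing 3 z by m, rather than z by m / 3, cuts the circle into thirds even when 3 does not
-- divide m.
arc : ∀ m .{{_ : NonZero m}} → ℤ → Fin 3
arc m z = mod3 ((+ 3 * z) /ℕ m)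

arc-≡ : ∀ m .{{_ : NonZero m}} {z} q → 0≤ + 3 * z - q * + m → 0≤ q * + m + + m - + 3 * z - 1ℤ → arc m z ≡ mod3 q
arc-≡ m {z} q lo hi = cong mod3 (/ℕ-unique {+ 3 * z} {q} m lo hi)

arc-periodic : ∀ m .{{_ : NonZero m}} → Periodic (+ m) (arc m)
arc-periodic m n k = trans (arc-≡ m {n + k * + m} (q + k * + 3)
  (/ℕ-lower (+ 3 * n) m by eq₁ n k q (+ m)) (/ℕ-upper (+ 3 * n) m by eq₂ n k q (+ m))) (mod3-shift q k)
  where
  q = (+ 3 * n) /ℕ m
  eq₁ : ∀ n k q m → + 3 * n - q * m ≡ + 3 * (n + k * m) - (q + k * + 3) * m
  eq₁ = solve-∀
  eq₂ : ∀ n k q m → q * m + m - + 3 * n - 1ℤ ≡ (q + k * + 3) * m + m - + 3 * (n + k * m) - 1ℤ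
  eq₂ = solve-∀

-- The four points 0, P, Q, R leave no gap longer than a third of the circle
-- ℤ / m, so every arc of that length meets each of their translates.
arc-hits : ∀ m .{{_ : NonZero m}} {P Q R} → 0≤ + m - + 3 * P → 0≤ + m + + 3 * P - + 3 * Q →
           0≤ + m + + 3 * Q - + 3 * R → 0≤ + 3 * R - + 2 * + m →
           Cover (arc m) (0ℤ ∷ P ∷ Q ∷ R ∷ [])
arc-hits m {P} {Q} {R} gP gQ gR gR′ z k with mod3-hit ((+ 3 * z) /ℕ m) k
... | 0 , _ , hit = 1st (trans (cong (arc m) (ℤ.+-identityʳ z)) (trans (cong mod3 (sym (ℤ.+-identityʳ ((+ 3 * z) /ℕ m)))) hit))
-- The wanted arc now begins beyond z. Each of z, z + P, z + Q, z + R exceeds its predecessor by at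
-- most m / 3, so the first one to reach the beginning of the arc is still inside it; z + R reaches
-- it because δ ≤ 2.
... | δ@(suc δ′) , δ<3 , hit
  with split (+ 3 * (z + P) - A) | split (+ 3 * (z + Q) - A)
  where A = ((+ 3 * z) /ℕ m + + δ) * + m
... | inj₁ p | _ = 2nd (trans (arc-≡ m {z + P} (q + + δ) p
      (gP ⊕ /ℕ-upper (+ 3 * z) m ⊕ 0≤+ δ′ ⊗ 0≤+ m by eq z q (+ m) P (+ δ′))) hit)
  where
  q = (+ 3 * z) /ℕ m
  eq : ∀ z q m P δ′ → m - + 3 * P + (q * m + m - + 3 * z - 1ℤ) + δ′ * m ≡
                      (q + (1ℤ + δ′)) * m + m - + 3 * (z + P) - 1ℤ
  eq = solve-∀
... | inj₂ p | inj₁ p′ = 3rd (trans (arc-≡ m {z + Q} (q + + δ) p′ (gQ ⊕ p by eq z ((q + + δ) * + m) (+ m) P Q)) hit)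
  where
  q = (+ 3 * z) /ℕ m
  eq : ∀ z A m P Q → m + + 3 * P - + 3 * Q + (- (+ 3 * (z + P) - A) - 1ℤ) ≡ A + m - + 3 * (z + Q) - 1ℤ
  eq = solve-∀
... | inj₂ _ | inj₂ p′ = 4th (trans (arc-≡ m {z + R} (q + + δ)
      (gR′ ⊕ /ℕ-lower (+ 3 * z) m ⊕ diff (+≤+ (ℕ.s≤s⁻¹ δ<3)) ⊗ 0≤+ m by eq₁ z q (+ m) R (+ δ))
      (gR ⊕ p′ by eq₂ z ((q + + δ) * + m) (+ m) Q R)) hit)
  where
  q = (+ 3 * z) /ℕ m
  eq₁ : ∀ z q m R δ → + 3 * R - + 2 * m + (+ 3 * z - q * m) + (+ 2 - δ) * m ≡ + 3 * (z + R) - (q + δ) * m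
  eq₁ = solve-∀
  eq₂ : ∀ z A m Q R → m + + 3 * Q - + 3 * R + (- (+ 3 * (z + Q) - A) - 1ℤ) ≡ A + m - + 3 * (z + R) - 1ℤ
  eq₂ = solve-∀

-- Multiplication by j is a homomorphism of ℤ / m, so it carries translates to translates. This
-- holds for every j, unit or not, which leaves j free to be found by pigeonhole or search.
pull-back : ∀ {m} j {a b c a′ b′ c′} →
  j * a ≈ a′ [ m ] → j * b ≈ b′ [ m ] → j * c ≈ c′ [ m ] →
  Colourable[ m ] (0ℤ ∷ a′ ∷ b′ ∷ c′ ∷ []) → Colourable[ m ] (0ℤ ∷ a ∷ b ∷ c ∷ [])
pull-back {m} j {a} {b} {c} {a′} {b′} {c′} ja jb jc (χ , periodic , cover) =
  (λ n → χ (j * n)) , periodic′ , cover′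
  where
  eq₁ : ∀ n k j m → j * (n + k * m) ≡ j * n + (j * k) * m
  eq₁ = solve-∀
  periodic′ : Periodic m (λ n → χ (j * n))
  periodic′ n k = trans (cong χ (eq₁ n k j m)) (periodic (j * n) (j * k))
  eq₂ : ∀ z P q → z + (P + q) ≡ z + P + q
  eq₂ = solve-∀
  move : ∀ n {s s′ k} → j * s ≈ s′ [ m ] → χ (j * n + s′) ≡ k → χ (j * (n + s)) ≡ k
  move n {s} {s′} (q , eq) hit = trans (cong χ
    (trans (ℤ.*-distribˡ-+ j n s) (trans (cong (λ w → j * n + w) eq) (eq₂ (j * n) s′ (q * m)))))
    (trans (periodic (j * n + s′) q) hit)
  cover′ : Cover (λ n → χ (j * n)) (0ℤ ∷ a ∷ b ∷ c ∷ [])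
  cover′ n k with cover (j * n) k
  ... | 1st h = 1st (move n {0ℤ} {0ℤ} (0ℤ , ℤ.*-zeroʳ j) h)
  ... | 2nd h = 2nd (move n {a} {a′} ja h)
  ... | 3rd h = 3rd (move n {b} {b′} jb h)
  ... | 4th h = 4th (move n {c} {c′} jc h)

arc-colouring : ∀ m .{{_ : NonZero m}} {P Q R} →
  0≤ + m - + 3 * P → 0≤ + m + + 3 * P - + 3 * Q →
  0≤ + m + + 3 * Q - + 3 * R → 0≤ + 3 * R - + 2 * + m →
  Colourable[ + m ] (0ℤ ∷ P ∷ Q ∷ R ∷ [])
arc-colouring m {P} {Q} {R} gP gQ gR gR′ = arc m , arc-periodic m , arc-hits m {P} {Q} {R} gP gQ gR gR′

-- Sums {0, x} + {0, y}, translates and dilates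

Grid : ℤ → ℤ → ℤ → Set
Grid m x y = Colourable[ m ] (0ℤ ∷ x ∷ y ∷ x + y ∷ [])

grid-swap : ∀ {m x y} → Grid m x y → Grid m y x
grid-swap {m} {x} {y} (χ , periodic , cover) = χ , periodic , cover′
  where
  cover′ : Cover χ (0ℤ ∷ y ∷ x ∷ y + x ∷ [])
  cover′ n k with cover n k
  ... | 1st h = 1st h
  ... | 2nd h = 3rd h
  ... | 3rd h = 2nd h
  ... | 4th h = 4th (trans (cong (λ s → χ (n + s)) (ℤ.+-comm y x)) h)

-- {0, x} is the translate of {0, - x} by x.
grid-neg : ∀ {m x y} → Grid m (- x) y → Grid m x y
grid-neg {m} {x} {y} (χ , periodic , cover) = χ , periodic , cover′
  where
  eq₁ : ∀ n x → n + x ≡ n + x + 0ℤ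
  eq₁ = solve-∀
  eq₂ : ∀ n x → n + 0ℤ ≡ n + x + - x
  eq₂ = solve-∀
  eq₃ : ∀ n x y → n + (x + y) ≡ n + x + y
  eq₃ = solve-∀
  eq₄ : ∀ n x y → n + y ≡ n + x + (- x + y)
  eq₄ = solve-∀
  cover′ : Cover χ (0ℤ ∷ x ∷ y ∷ x + y ∷ [])
  cover′ n k with cover (n + x) k
  ... | 1st h = 2nd (trans (cong χ (eq₁ n x)) h)
  ... | 2nd h = 1st (trans (cong χ (eq₂ n x)) h)
  ... | 3rd h = 4th (trans (cong χ (eq₃ n x y)) h)
  ... | 4th h = 3rd (trans (cong χ (eq₄ n x y)) h)

-- Modulo b + c - a the element a may be replaced by b + c.
grid⇒colourable : ∀ {a b c} → Grid (b + c - a) b c → Colourable (0ℤ ∷ a ∷ b ∷ c ∷ [])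
grid⇒colourable {a} {b} {c} (χ , periodic , cover) = χ , cover′
  where
  eq : ∀ n a b c → n + (b + c) ≡ n + a + 1ℤ * (b + c - a)
  eq = solve-∀
  cover′ : Cover χ (0ℤ ∷ a ∷ b ∷ c ∷ [])
  cover′ n k with cover n k
  ... | 1st h = 1st h
  ... | 2nd h = 3rd h
  ... | 3rd h = 4th h
  ... | 4th h = 2nd (trans (sym (periodic (n + a) 1ℤ)) (trans (cong χ (sym (eq n a b c))) h))

translate-colourable : ∀ t {S} → Colourable S → Colourable (map (λ s → t + s) S)
translate-colourable t (χ , cover) = χ , λ n k →
  Any.map⁺ (Any.map (λ {s} h → trans (cong χ (sym (ℤ.+-assoc n t s))) h) (cover (n + t) k))

-- Every coset of g ℤ is a copy of ℤ under n ↦ ⌊n / g⌋, and adding g s moves the copy by s.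
scale-colourable : ∀ g .{{_ : NonZero g}} {S} → Colourable S → Colourable (map (λ s → + g * s) S)
scale-colourable g (χ , cover) = (λ n → χ (n /ℕ g)) , λ n k →
  Any.map⁺ (Any.map (λ {s} h → trans (cong χ (/ℕ-shift n s)) h) (cover (n /ℕ g) k))
  where
  eq₁ : ∀ n q g s → n - q * g ≡ n + g * s - (q + s) * g
  eq₁ = solve-∀
  eq₂ : ∀ n q g s → q * g + g - n - 1ℤ ≡ (q + s) * g + g - (n + g * s) - 1ℤ
  eq₂ = solve-∀
  /ℕ-shift : ∀ n s → (n + + g * s) /ℕ g ≡ n /ℕ g + s
  /ℕ-shift n s = /ℕ-unique {n + + g * s} {n /ℕ g + s} g
    (/ℕ-lower n g by eq₁ n (n /ℕ g) (+ g) s) (/ℕ-upper n g by eq₂ n (n /ℕ g) (+ g) s)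

-- The exceptional set {0, 1, h − 1, h} modulo 2 h

-- A word w of period 2 h is written as columns (w i , w (i + h)), i < h; column
-- h is then column 0 swapped.  A window consists of the columns i − 1, i, i + 1
-- and controls the translates by i and by i + h.
Column : Set
Column = Fin 3 × Fin 3

Window : Column → Column → Column → Set
Window (u₀ , v₀) (u₁ , v₁) (u₂ , v₂) =
  (∀ k → Any (_≡ k) (u₁ ∷ u₂ ∷ v₀ ∷ v₁ ∷ [])) × (∀ k → Any (_≡ k) (v₁ ∷ v₂ ∷ u₀ ∷ u₁ ∷ []))

window? : ∀ P Q R → Dec (Window P Q R)
window? P Q R = Fin.all? (λ k → Any.any? (Fin._≟ k) _) ×-dec Fin.all? (λ k → Any.any? (Fin._≟ k) _)

window! : ∀ P Q R {_ : True (window? P Q R)} → Window P Q R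
window! P Q R {t} = toWitness t

-- The columns (0 0) (1 2) are repeated, and a tail closes the word up: (2 1)
-- for odd h, and (0 1) (2 2) (0 1) (2 1) for even h.
columns : (ℕ → Column) → ℕ → ℕ → Column
columns tail zero    k             = tail k
columns tail (suc i) 0             = 0F , 0F
columns tail (suc i) 1             = 1F , 2F
columns tail (suc i) (suc (suc k)) = columns tail i k

twice_plus_ : ℕ → ℕ → ℕ
twice zero  plus l = l
twice suc i plus l = suc (suc (twice i plus l))

-- `end` and `end′` make columns h and h + 1 equal to columns 0 and 1 with the rows exchanged, so
-- that the word closes up. `first` and `second` are the windows that straddle the passage from the
-- repeated block into the tail.
record Tail (l : ℕ) : Set where
  field
    tail    : ℕ → Column
    windows : ∀ k → k ℕ.< l → Window (tail k) (tail (1 ℕ.+ k)) (tail (2 ℕ.+ k))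
    first   : Window (0F , 0F) (1F , 2F) (tail 0)
    second  : Window (1F , 2F) (tail 0) (tail 1)
    end     : tail l ≡ (0F , 0F)
    end′    : tail (suc l) ≡ (2F , 1F)

oddTail : Tail 1
oddTail = record
  { tail    = tail
  ; windows = λ { 0 _ → window! _ _ _ ; (suc k) (ℕ.s≤s ()) }
  ; first   = window! _ _ _
  ; second  = window! _ _ _
  ; end     = refl
  ; end′    = refl
  }
  where
  tail : ℕ → Column
  tail 1 = 0F , 0F
  tail _ = 2F , 1F

evenTail : Tail 4
evenTail = record
  { tail    = tail
  ; windows = λ { 0 _ → window! _ _ _ ; 1 _ → window! _ _ _ ; 2 _ → window! _ _ _ ; 3 _ → window! _ _ _
                ; (suc (suc (suc (suc k)))) (ℕ.s≤s (ℕ.s≤s (ℕ.s≤s (ℕ.s≤s ())))) }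
  ; first   = window! _ _ _
  ; second  = window! _ _ _
  ; end     = refl
  ; end′    = refl
  }
  where
  tail : ℕ → Column
  tail 0 = 0F , 1F
  tail 1 = 2F , 2F
  tail 2 = 0F , 1F
  tail 3 = 2F , 1F
  tail 4 = 0F , 0F
  tail _ = 2F , 1F

pick′ : ℕ → Column → Fin 3
pick′ zero    = proj₁
pick′ (suc _) = proj₂

-- The parity of q selects the row, since each passage through h columns exchanges the two rows.
pick : ℤ → Column → Fin 3
pick q = pick′ (q %ℕ 2)

parity : ∀ q → (∃[ s ] q ≡ s * + 2) ⊎ (∃[ s ] q ≡ 1ℤ + s * + 2)
parity q with q %ℕ 2 | n%ℕd<d q 2 | a≡a%ℕn+[a/ℕn]*n q 2
... | 0 | _ | eq = inj₁ (q /ℕ 2 , trans eq (ℤ.+-identityˡ _))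
... | 1 | _ | eq = inj₂ (q /ℕ 2 , eq)
... | suc (suc _) | ℕ.s≤s (ℕ.s≤s ()) | _

pick-even : ∀ s c → pick (s * + 2) c ≡ proj₁ c
pick-even s c = cong (λ r → pick′ r c) (%ℕ-unique {q = s} 2 0 ℕ.z<s (sym (ℤ.+-identityˡ (s * + 2))))

pick-odd : ∀ s c → pick (1ℤ + s * + 2) c ≡ proj₂ c
pick-odd s c = cong (λ r → pick′ r c) (%ℕ-unique {q = s} 2 1 (ℕ.s<s ℕ.z<s) refl)

pick-suc : ∀ q c → pick (q + 1ℤ) c ≡ pick q (Product.swap c)
pick-suc q c with parity q
... | inj₁ (s , refl) = trans (cong (λ w → pick w c) (ℤ.+-comm (s * + 2) 1ℤ))
                          (trans (pick-odd s c) (sym (pick-even s (Product.swap c))))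
... | inj₂ (s , refl) = trans (cong (λ w → pick w c) (eq s))
                          (trans (pick-even (s + 1ℤ) c) (sym (pick-odd s (Product.swap c))))
  where
  eq : ∀ s → 1ℤ + s * + 2 + 1ℤ ≡ (s + 1ℤ) * + 2
  eq = solve-∀

pick-periodic : ∀ q k c → pick (q + k * + 2) c ≡ pick q c
pick-periodic q k c with parity q
... | inj₁ (s , refl) = trans (cong (λ w → pick w c) (sym (ℤ.*-distribʳ-+ (+ 2) s k)))
                          (trans (pick-even (s + k) c) (sym (pick-even s c)))
... | inj₂ (s , refl) = trans (cong (λ w → pick w c) (eq s k))
                          (trans (pick-odd (s + k) c) (sym (pick-odd s c)))
  where
  eq : ∀ s k → 1ℤ + s * + 2 + k * + 2 ≡ 1ℤ + (s + k) * + 2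
  eq = solve-∀

module Word {l} (τ : Tail l) (i : ℕ) where
  open Tail τ

  h : ℕ
  h = twice suc i plus l

  C : ℕ → Column
  C = columns tail (suc i)

  columns-windows : ∀ i k → k ℕ.< twice i plus l →
    Window (columns tail i k) (columns tail i (1 ℕ.+ k)) (columns tail i (2 ℕ.+ k))
  columns-windows zero          k             k<l = windows k k<l
  columns-windows (suc zero)    0             _   = first
  columns-windows (suc zero)    1             _   = second
  columns-windows (suc (suc i)) 0             _   = window! _ _ _
  columns-windows (suc (suc i)) 1             _   = window! _ _ _
  columns-windows (suc i)       (suc (suc k)) k<  = columns-windows i k (ℕ.s<s⁻¹ (ℕ.s<s⁻¹ k<))

  columns-end : ∀ i k → columns tail i (k ℕ.+ twice i plus l) ≡ tail (k ℕ.+ l)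
  columns-end zero    k = refl
  columns-end (suc i) k = trans (cong (columns tail (suc i)) (ℕ.+-suc k (suc (twice i plus l))))
    (trans (cong (λ w → columns tail (suc i) (suc w)) (ℕ.+-suc k (twice i plus l))) (columns-end i k))

  χ : ℤ → Fin 3
  χ z = pick (z /ℕ h) (C (z %ℕ h))

  χ-at-< : ∀ r q → r ℕ.< h → χ (+ r + q * + h) ≡ pick q (C r)
  χ-at-< r q r<h = cong₂ (λ q r → pick q (C r))
    (/ℕ-unique {+ r + q * + h} {q} h (0≤+ r by eq₁ (+ r) (q * + h)) (diff< (+<+ r<h) by eq₂ (+ r) (q * + h) (+ h)))
    (%ℕ-unique {q = q} h r r<h refl)
    where
    eq₁ : ∀ r p → r ≡ r + p - p
    eq₁ = solve-∀
    eq₂ : ∀ r p m → m - r - 1ℤ ≡ p + m - (r + p) - 1ℤ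
    eq₂ = solve-∀

  χ-wrap : ∀ j q → j ℕ.< h → C (j ℕ.+ h) ≡ Product.swap (C j) → χ (+ (j ℕ.+ h) + q * + h) ≡ pick q (C (j ℕ.+ h))
  χ-wrap j q j<h eq = trans (cong χ (eq₁ (+ j) (+ h) q)) (trans (χ-at-< j (q + 1ℤ) j<h)
    (trans (pick-suc q (C j)) (cong (pick q) (sym eq))))
    where
    eq₁ : ∀ j h q → j + h + q * h ≡ j + (q + 1ℤ) * h
    eq₁ = solve-∀

  -- A window that starts at column h - 1 reaches column h + 1, whence the bound. Columns h and h +
  -- 1 are columns 0 and 1 of the next block, read with exchanged rows.
  χ-at : ∀ r q → r ℕ.≤ suc h → χ (+ r + q * + h) ≡ pick q (C r)
  χ-at r q r≤1+h with ℕ.m≤n⇒m<n∨m≡n r≤1+h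
  ... | inj₂ refl = χ-wrap 1 q (ℕ.s<s ℕ.z<s) (trans (columns-end (suc i) 1) end′)
  ... | inj₁ (ℕ.s≤s r≤h) with ℕ.m≤n⇒m<n∨m≡n r≤h
  ...   | inj₁ r<h  = χ-at-< r q r<h
  ...   | inj₂ refl = χ-wrap 0 q ℕ.z<s (trans (columns-end (suc i) 0) end)

  χ-periodic : Periodic (+ 2 * + h) χ
  χ-periodic n k = trans (cong χ (trans (cong (λ w → w + k * (+ 2 * + h)) n≡) (eq (+ r) q k (+ h))))
    (trans (χ-at-< r (q + k * + 2) r<h) (trans (pick-periodic q k (C r)) refl))
    where
    r = n %ℕ h
    q = n /ℕ h
    r<h = n%ℕd<d n h
    n≡ : n ≡ + r + q * + h
    n≡ = a≡a%ℕn+[a/ℕn]*n n h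
    eq : ∀ r q k h → r + q * h + k * (+ 2 * h) ≡ r + (q + k * + 2) * h
    eq = solve-∀

  χ-cover : Cover χ (0ℤ ∷ 1ℤ ∷ + h - 1ℤ ∷ + h ∷ [])
  χ-cover n k = go (full q (columns-windows (suc i) r r<h))
    where
    -- The window that controls n starts one column before n.
    r = (n - 1ℤ) %ℕ h
    q = (n - 1ℤ) /ℕ h
    r<h = n%ℕd<d (n - 1ℤ) h
    full : ∀ q → Window (C r) (C (1 ℕ.+ r)) (C (2 ℕ.+ r)) →
      Any (_≡ k) (pick q (C (1 ℕ.+ r)) ∷ pick q (C (2 ℕ.+ r)) ∷
                  pick q (Product.swap (C r)) ∷ pick q (Product.swap (C (1 ℕ.+ r))) ∷ [])
    -- In a block of odd index the rows are exchanged; that is the second half of the window.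
    full q (w₁ , w₂) with q %ℕ 2
    ... | zero  = w₁ k
    ... | suc _ = w₂ k
    n-1≡ : n - 1ℤ ≡ + r + q * + h
    n-1≡ = a≡a%ℕn+[a/ℕn]*n (n - 1ℤ) h
    place : ∀ s r′ q′ → n - 1ℤ + (1ℤ + s) ≡ + r′ + q′ * + h → r′ ℕ.≤ suc h → χ (n + s) ≡ pick q′ (C r′)
    place s r′ q′ eq r′≤ = trans (cong χ (trans (eq′ n s) eq)) (χ-at r′ q′ r′≤)
      where
      eq′ : ∀ n s → n + s ≡ n - 1ℤ + (1ℤ + s)
      eq′ = solve-∀
    1+r≤ : suc r ℕ.≤ suc h
    1+r≤ = ℕ.s≤s (ℕ.<⇒≤ r<h)
    eq₁ : ∀ r p → r + p + 1ℤ ≡ 1ℤ + r + p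
    eq₁ = solve-∀
    eq₂ : ∀ r p → r + p + + 2 ≡ + 2 + r + p
    eq₂ = solve-∀
    eq₃ : ∀ r q h → r + q * h + (1ℤ + (h - 1ℤ)) ≡ r + (q + 1ℤ) * h
    eq₃ = solve-∀
    eq₄ : ∀ r q h → r + q * h + (1ℤ + h) ≡ 1ℤ + r + (q + 1ℤ) * h
    eq₄ = solve-∀
    at₁ : χ (n + 0ℤ) ≡ pick q (C (1 ℕ.+ r))
    at₁ = place 0ℤ (suc r) q (trans (cong (λ w → w + 1ℤ) n-1≡) (eq₁ (+ r) (q * + h))) 1+r≤
    at₂ : χ (n + 1ℤ) ≡ pick q (C (2 ℕ.+ r))
    at₂ = place 1ℤ (suc (suc r)) q (trans (cong (λ w → w + + 2) n-1≡) (eq₂ (+ r) (q * + h))) (ℕ.s≤s r<h)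
    at₃ : χ (n + (+ h - 1ℤ)) ≡ pick q (Product.swap (C r))
    at₃ = trans (place (+ h - 1ℤ) r (q + 1ℤ) (trans (cong (λ w → w + (1ℤ + (+ h - 1ℤ))) n-1≡) (eq₃ (+ r) q (+ h)))
            (ℕ.≤-trans (ℕ.n≤1+n r) 1+r≤)) (pick-suc q (C r))
    at₄ : χ (n + + h) ≡ pick q (Product.swap (C (1 ℕ.+ r)))
    at₄ = trans (place (+ h) (suc r) (q + 1ℤ) (trans (cong (λ w → w + (1ℤ + + h)) n-1≡) (eq₄ (+ r) q (+ h))) 1+r≤)
            (pick-suc q (C (1 ℕ.+ r)))
    go : Any (_≡ k) (pick q (C (1 ℕ.+ r)) ∷ pick q (C (2 ℕ.+ r)) ∷
                     pick q (Product.swap (C r)) ∷ pick q (Product.swap (C (1 ℕ.+ r))) ∷ []) →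
         Any (λ s → χ (n + s) ≡ k) (0ℤ ∷ 1ℤ ∷ + h - 1ℤ ∷ + h ∷ [])
    go (1st e) = 1st (trans at₁ e)
    go (2nd e) = 2nd (trans at₂ e)
    go (3rd e) = 3rd (trans at₃ e)
    go (4th e) = 4th (trans at₄ e)

-- The bound excludes h = 4, where no word exists: a colour with at most two of the eight residues
-- would need {0, 1, 3, 4} to tile ℤ / 8.
halves : ∀ h → 5 ℕ.≤ h → ∃[ i ] (h ≡ twice suc i plus 1 ⊎ h ≡ twice suc i plus 4)
halves 1 (ℕ.s≤s ())
halves 2 (ℕ.s≤s (ℕ.s≤s ()))
halves 3 (ℕ.s≤s (ℕ.s≤s (ℕ.s≤s ())))
halves 4 (ℕ.s≤s (ℕ.s≤s (ℕ.s≤s (ℕ.s≤s ()))))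
halves 5 _ = 1 , inj₁ refl
halves 6 _ = 0 , inj₂ refl
halves (suc (suc h@(suc (suc (suc (suc (suc _))))))) _ with halves h (ℕ.s≤s (ℕ.s≤s (ℕ.s≤s (ℕ.s≤s (ℕ.s≤s ℕ.z≤n)))))
... | i , inj₁ eq = suc i , inj₁ (cong (λ w → suc (suc w)) eq)
... | i , inj₂ eq = suc i , inj₂ (cong (λ w → suc (suc w)) eq)

word-colouring : ∀ h → 5 ℕ.≤ h → Colourable[ + 2 * + h ] (0ℤ ∷ 1ℤ ∷ + h - 1ℤ ∷ + h ∷ [])
word-colouring h 5≤h with halves h 5≤h
... | i , inj₁ refl = let open Word oddTail i in χ , χ-periodic , χ-cover
... | i , inj₂ refl = let open Word evenTail i in χ , χ-periodic , χ-cover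

-- Pairs with 2 (x + y) ≡ 0, reduced to the exceptional set

Bézout₃ : ℤ → ℤ → ℤ → Set
Bézout₃ m x y = ∃[ α ] ∃[ β ] ∃[ γ ] α * x + β * y + γ * m ≡ 1ℤ

-- Since y ≡ - x modulo h, a common divisor of x and h divides y as well.
bézout-half : ∀ {h x y} k → Bézout₃ (+ 2 * h) x y → x + y ≡ h + k * (+ 2 * h) → ∃[ a ] ∃[ b ] a * x + b * h ≡ 1ℤ
bézout-half {h} {x} {y} k (α , β , γ , bez) eq = α - β , β * (1ℤ + k * + 2) + γ * + 2 ,
  trans (trans (eq₁ α β γ x h k) (cong (λ w → α * x + β * (w - x) + γ * (+ 2 * h)) (sym eq))) (trans (eq₂ α β γ x y h) bez)
  where
  eq₁ : ∀ α β γ x h k → (α - β) * x + (β * (1ℤ + k * + 2) + γ * + 2) * h ≡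
        α * x + β * (h + k * (+ 2 * h) - x) + γ * (+ 2 * h)
  eq₁ = solve-∀
  eq₂ : ∀ α β γ x y h → α * x + β * (x + y - x) + γ * (+ 2 * h) ≡ α * x + β * y + γ * (+ 2 * h)
  eq₂ = solve-∀

-- Being odd and coprime to h, x has an inverse u modulo 2 h. As u is odd, it fixes h modulo 2 h,
-- and so it sends y ≡ h - x to h - 1.
half-grid-odd : ∀ h → 5 ℕ.≤ h → ∀ {x y} k s a b → x + y ≡ + h + k * (+ 2 * + h) → a * x + b * + h ≡ 1ℤ →
  x ≡ 1ℤ + s * + 2 → Grid (+ 2 * + h) x y
half-grid-odd h 5≤h {x} {y} k s a b x+y≡ bez x≡ = pull-back {+ 2 * + h} u
  {x} {y} {x + y} {1ℤ} {+ h - 1ℤ} {+ h} (s * b , ux≡) (κ + k * u - s * b , uy≡) (κ + k * u , uxy≡) (word-colouring h 5≤h)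
  where
  H = + h
  -- The coefficient a inverts x only modulo h. With the correction b h, u x = 1 + b h (x - 1), and
  -- x - 1 is even.
  u = a + b * H
  κ = s * b * H - u * s
  ux≡ : u * x ≡ 1ℤ + s * b * (+ 2 * H)
  ux≡ = trans (eq₁ a b x H) (trans (cong₂ (λ v w → v + b * H * (w - 1ℤ)) bez x≡) (eq₂ b s H))
    where
    eq₁ : ∀ a b x H → (a + b * H) * x ≡ a * x + b * H + b * H * (x - 1ℤ)
    eq₁ = solve-∀
    eq₂ : ∀ b s H → 1ℤ + b * H * (1ℤ + s * + 2 - 1ℤ) ≡ 1ℤ + s * b * (+ 2 * H)
    eq₂ = solve-∀
  u≡ : u ≡ 1ℤ + κ * + 2
  u≡ = trans (eq₁ u s) (trans (cong (λ w → u * w - u * (s * + 2)) (sym x≡))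
         (trans (cong (λ w → w - u * (s * + 2)) ux≡) (eq₂ u s b H)))
    where
    eq₁ : ∀ u s → u ≡ u * (1ℤ + s * + 2) - u * (s * + 2)
    eq₁ = solve-∀
    eq₂ : ∀ u s b H → 1ℤ + s * b * (+ 2 * H) - u * (s * + 2) ≡ 1ℤ + (s * b * H - u * s) * + 2
    eq₂ = solve-∀
  uxy≡ : u * (x + y) ≡ H + (κ + k * u) * (+ 2 * H)
  uxy≡ = trans (cong (λ w → u * w) x+y≡) (trans (eq₁ u k H)
           (trans (cong (λ w → w * H + k * u * (+ 2 * H)) u≡) (eq₂ κ (k * u) H)))
    where
    eq₁ : ∀ u k H → u * (H + k * (+ 2 * H)) ≡ u * H + k * u * (+ 2 * H)
    eq₁ = solve-∀
    eq₂ : ∀ κ v H → (1ℤ + κ * + 2) * H + v * (+ 2 * H) ≡ H + (κ + v) * (+ 2 * H)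
    eq₂ = solve-∀
  uy≡ : u * y ≡ H - 1ℤ + (κ + k * u - s * b) * (+ 2 * H)
  uy≡ = trans (eq₁ u x y) (trans (cong₂ _-_ uxy≡ ux≡) (eq₂ H (κ + k * u) (s * b)))
    where
    eq₁ : ∀ u x y → u * y ≡ u * (x + y) - u * x
    eq₁ = solve-∀
    eq₂ : ∀ H v w → H + v * (+ 2 * H) - (1ℤ + w * (+ 2 * H)) ≡ H - 1ℤ + (v - w) * (+ 2 * H)
    eq₂ = solve-∀

even≢1 : ∀ z → ¬ z * + 2 ≡ 1ℤ
even≢1 z eq with () ← trans (sym (pick-even z (0F , 1F))) (cong (λ w → pick w (0F , 1F)) eq)

-- If x and y were both even, then so would be h, against the coprimality of x and h. Hence one of
-- them is odd and can be taken to 1.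
half-grid : ∀ h → 5 ℕ.≤ h → ∀ {x y} → Bézout₃ (+ 2 * + h) x y → x + y ≈ + h [ + 2 * + h ] → Grid (+ 2 * + h) x y
half-grid h 5≤h {x} {y} bez (k , eq) with bézout-half {+ h} k bez eq | parity x | parity y
... | a , b , ab | inj₂ (s , x≡) | _ = half-grid-odd h 5≤h k s a b eq ab x≡
... | a , b , ab | inj₁ (s , x≡) | inj₂ (t , y≡) =
  grid-swap {x = y} {x} (half-grid-odd h 5≤h k t (- a) (b + a * (1ℤ + k * + 2)) (trans (ℤ.+-comm y x) eq)
    (trans (trans (eq₁ a b k y (+ h)) (cong (λ w → a * (w - y) + b * + h) (sym eq))) (trans (eq₂ a b x y (+ h)) ab)) y≡)
  where
  eq₁ : ∀ a b k y h → - a * y + (b + a * (1ℤ + k * + 2)) * h ≡ a * (h + k * (+ 2 * h) - y) + b * h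
  eq₁ = solve-∀
  eq₂ : ∀ a b x y h → a * (x + y - y) + b * h ≡ a * x + b * h
  eq₂ = solve-∀
... | a , b , ab | inj₁ (s , x≡) | inj₁ (t , y≡) = contradiction
  (trans (trans (eq₁ a b s t k (+ h)) (cong₂ (λ v w → a * v + b * (v + w - k * (+ 2 * + h))) (sym x≡) (sym y≡)))
    (trans (cong (λ w → a * x + b * (w - k * (+ 2 * + h))) eq) (trans (eq₂ a b x (+ h) (k * (+ 2 * + h))) ab)))
  (even≢1 (a * s + b * (s + t - k * + h)))
  where
  eq₁ : ∀ a b s t k h → (a * s + b * (s + t - k * h)) * + 2 ≡ a * (s * + 2) + b * (s * + 2 + t * + 2 - k * (+ 2 * h))
  eq₁ = solve-∀
  eq₂ : ∀ a b x h w → a * x + b * (h + w - w) ≡ a * x + b * h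
  eq₂ = solve-∀

-- If m divides 2 (x + y) but not x + y, then m = 2 h and x + y ≡ h.
exceptional-grid : ∀ m → 10 ℕ.≤ m → ∀ {x y} → Bézout₃ (+ m) x y → + 2 * (x + y) ≈ 0ℤ [ + m ] →
  ¬ (x + y ≈ 0ℤ [ + m ]) → Grid (+ m) x y
exceptional-grid m 10≤m {x} {y} bez (k , eq) ≉0 with parity k | parity (+ m)
... | inj₁ (s , k≡) | _ = contradiction (s , ℤ.*-cancelˡ-≡ (+ 2) (x + y) (0ℤ + s * + m)
        (trans eq (trans (cong (λ w → 0ℤ + w * + m) k≡) (eq₁ s (+ m))))) ≉0
  where
  eq₁ : ∀ s m → 0ℤ + s * + 2 * m ≡ + 2 * (0ℤ + s * m)
  eq₁ = solve-∀
... | inj₂ (s , k≡) | inj₂ (t , m≡) = contradiction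
      (trans (eq₁ (x + y) s t) (trans (cong (λ w → w - (s * + 2 * (1ℤ + t * + 2) + t * + 2))
        (trans eq (cong₂ (λ v w → 0ℤ + v * w) k≡ m≡))) (eq₂ s t)))
      (even≢1 (x + y - (s * (1ℤ + t * + 2) + t)))
  where
  eq₁ : ∀ z s t → (z - (s * (1ℤ + t * + 2) + t)) * + 2 ≡ + 2 * z - (s * + 2 * (1ℤ + t * + 2) + t * + 2)
  eq₁ = solve-∀
  eq₂ : ∀ s t → 0ℤ + (1ℤ + s * + 2) * (1ℤ + t * + 2) - (s * + 2 * (1ℤ + t * + 2) + t * + 2) ≡ 1ℤ
  eq₂ = solve-∀
... | inj₂ (s , k≡) | inj₁ (-[1+ t ] , m≡) = contradiction (subst (0ℤ ℤ.≤_) m≡ (0≤+ m)) λ ()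
... | inj₂ (s , k≡) | inj₁ (+ h , m≡) = subst (λ w → Grid w x y) (sym m≡2h)
  (half-grid h 5≤h (subst (λ w → Bézout₃ w x y) m≡2h bez) (s , ℤ.*-cancelˡ-≡ (+ 2) (x + y) (+ h + s * (+ 2 * + h))
    (trans eq (trans (cong₂ (λ v w → 0ℤ + v * w) k≡ m≡2h) (eq₁ s (+ h))))))
  where
  m≡2h : + m ≡ + 2 * + h
  m≡2h = trans m≡ (ℤ.*-comm (+ h) (+ 2))
  5≤h : 5 ℕ.≤ h
  5≤h = ℕ.*-cancelˡ-≤ 2 (subst (10 ℕ.≤_) (ℤ.+-injective (trans m≡2h (sym (ℤ.pos-* 2 h)))) 10≤m)
  eq₁ : ∀ s h → 0ℤ + (1ℤ + s * + 2) * (+ 2 * h) ≡ + 2 * (h + s * (+ 2 * h))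
  eq₁ = solve-∀

-- Generic pairs and rules for congruences

-- The four incongruences say that 0, x, y, x + y are distinct modulo m. In this form they are
-- visibly permuted by the exchange of x and y and by changes of sign.
record Generic (m x y : ℤ) : Set where
  field
    bézout₃ : Bézout₃ m x y
    x≉0     : ¬ (x ≈ 0ℤ [ m ])
    y≉0     : ¬ (y ≈ 0ℤ [ m ])
    x+y≉0   : ¬ (x + y ≈ 0ℤ [ m ])
    -x+y≉0  : ¬ (- x + y ≈ 0ℤ [ m ])

open Generic

neg-≈0 : ∀ {m z} → - z ≈ 0ℤ [ m ] → z ≈ 0ℤ [ m ]
neg-≈0 {m} {z} (k , eq) = - k , trans (sym (ℤ.neg-involutive z)) (trans (cong -_ eq) (eq₁ k m))
  where
  eq₁ : ∀ k m → - (0ℤ + k * m) ≡ 0ℤ + - k * m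
  eq₁ = solve-∀

generic-swap : ∀ {m x y} → Generic m x y → Generic m y x
generic-swap {m} {x} {y} G = let α , β , γ , bez = bézout₃ G in record
  { bézout₃ = β , α , γ , trans (cong (λ w → w + γ * m) (ℤ.+-comm (β * y) (α * x))) bez
  ; x≉0     = y≉0 G
  ; y≉0     = x≉0 G
  ; x+y≉0   = λ h → x+y≉0 G (subst (_≈ 0ℤ [ m ]) (ℤ.+-comm y x) h)
  ; -x+y≉0  = λ h → -x+y≉0 G (neg-≈0 (subst (_≈ 0ℤ [ m ]) (eq x y) h))
  }
  where
  eq : ∀ x y → - y + x ≡ - (- x + y)
  eq = solve-∀

generic-neg : ∀ {m x y} → Generic m x y → Generic m (- x) y
generic-neg {m} {x} {y} G = let α , β , γ , bez = bézout₃ G in record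
  { bézout₃ = - α , β , γ , trans (cong (λ w → w + β * y + γ * m) (eq α x)) bez
  ; x≉0     = x≉0 G ∘ neg-≈0
  ; y≉0     = y≉0 G
  ; x+y≉0   = -x+y≉0 G
  ; -x+y≉0  = x+y≉0 G ∘ subst (λ w → w + y ≈ 0ℤ [ m ]) (ℤ.neg-involutive x)
  }
  where
  eq : ∀ α x → - α * - x ≡ α * x
  eq = solve-∀

≈-scale : ∀ {m} t {z w} → z ≈ w [ m ] → t * z ≈ t * w [ m ]
≈-scale {m} t {z} {w} (k , eq) = t * k , trans (cong (λ v → t * v) eq) (eq₁ t w k m)
  where
  eq₁ : ∀ t w k m → t * (w + k * m) ≡ t * w + t * k * m
  eq₁ = solve-∀

≈-+ : ∀ {m z w z′ w′} → z ≈ w [ m ] → z′ ≈ w′ [ m ] → z + z′ ≈ w + w′ [ m ]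
≈-+ {m} {z} {w} {z′} {w′} (k , eq) (k′ , eq′) = k + k′ , trans (cong₂ _+_ eq eq′) (eq₁ w w′ k k′ m)
  where
  eq₁ : ∀ w w′ k k′ m → w + k * m + (w′ + k′ * m) ≡ w + w′ + (k + k′) * m
  eq₁ = solve-∀

≈-reflexive : ∀ {m z w} → z ≡ w → z ≈ w [ m ]
≈-reflexive {m} {z} {w} eq = 0ℤ , trans eq (sym (ℤ.+-identityʳ w))

≈-trans : ∀ {m a b c} → a ≈ b [ m ] → b ≈ c [ m ] → a ≈ c [ m ]
≈-trans {m} {a} {b} {c} (k , refl) (l , refl) = l + k , eq c k l m
  where
  eq : ∀ c k l m → c + l * m + k * m ≡ c + (l + k) * m
  eq = solve-∀

-- Triangles of the torus and walks into them

-- The three inequalities cut out the triangle with corners (m / 6, m / 2), (m / 3, m / 3), (m / 3,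
-- 2 m / 3). Of the four gaps of 0, X, Y, X + Y the first and the third are both X.
triangle-grid : ∀ m .{{_ : NonZero m}} j {x y X Y} → j * x ≈ X [ + m ] → j * y ≈ Y [ + m ] →
  0≤ + m - + 3 * X → 0≤ + m + + 3 * X - + 3 * Y → 0≤ + 3 * (X + Y) - + 2 * + m → Grid (+ m) x y
triangle-grid m j {x} {y} {X} {Y} jx jy gX gY gXY =
  pull-back j {x} {y} {x + y} {X} {Y} {X + Y} jx jy
    (≈-trans (≈-reflexive (ℤ.*-distribˡ-+ j x y)) (≈-+ {z = j * x} {w = X} {z′ = j * y} {w′ = Y} jx jy))
    (arc-colouring m {X} {Y} {X + Y} gX gY (gX by eq (+ m) X Y) gXY)
  where
  eq : ∀ m X Y → m - + 3 * X ≡ m + + 3 * Y - + 3 * (X + Y)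
  eq = solve-∀

-- The last term of the progression B + t q that does not exceed U / 3.
window : ∀ q .{{_ : NonZero q}} B U → ∃[ t ] 0≤ U - + 3 * (B + t * + q) × 0≤ + 3 * (B + t * + q) + + 3 * + q - U
window q B U = t , (/ℕ-lower z d by trans (cong (λ w → z - t * w) d≡) (eq₁ B U t (+ q))) ,
  (/ℕ-upper z d ⊕ 0≤+ 1 by trans (cong (λ w → t * w + w - z - 1ℤ + 1ℤ) d≡) (eq₂ B U t (+ q)))
  where
  instance d≢0 = ℕ.m*n≢0 3 q
  d = 3 ℕ.* q
  z = U - + 3 * B
  t = z /ℕ d
  d≡ : + d ≡ + 3 * + q
  d≡ = ℤ.pos-* 3 q
  eq₁ : ∀ B U t q → U - + 3 * B - t * (+ 3 * q) ≡ U - + 3 * (B + t * q)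
  eq₁ = solve-∀
  eq₂ : ∀ B U t q → t * (+ 3 * q) + + 3 * q - (U - + 3 * B) - 1ℤ + 1ℤ ≡ + 3 * (B + t * q) + + 3 * q - U
  eq₂ = solve-∀

-- The first multiple of X to reach U / c.
climb : ∀ c .{{_ : NonZero c}} {X} → 0≤ X - 1ℤ → ∀ U →
        ∃[ t ] 0≤ + c * (t * X) - U × 0≤ U + + c * X - + c * (t * X)
climb c {+ zero} () U
climb c { -[1+ _ ] } () U
climb c {+ X@(suc _)} _ U = - t , (/ℕ-lower (- U) d by trans (cong (λ w → - U - t * w) d≡) (eq₁ U t (+ c) (+ X))) ,
  (/ℕ-upper (- U) d ⊕ 0≤+ 1 by trans (cong (λ w → t * w + w - - U - 1ℤ + 1ℤ) d≡) (eq₂ U t (+ c) (+ X)))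
  where
  instance d≢0 = ℕ.m*n≢0 c X
  d = c ℕ.* X
  t = (- U) /ℕ d
  d≡ : + d ≡ + c * + X
  d≡ = ℤ.pos-* c X
  eq₁ : ∀ U t c X → - U - t * (c * X) ≡ c * (- t * X) - U
  eq₁ = solve-∀
  eq₂ : ∀ U t c X → t * (c * X) + c * X - - U - 1ℤ + 1ℤ ≡ U + c * X - c * (- t * X)
  eq₂ = solve-∀

module _ (m : ℕ) .{{_ : NonZero m}} where

  not-multiple : ∀ {z} → 0≤ z - 1ℤ → 0≤ + m - 1ℤ - z → ¬ (z ≈ 0ℤ [ + m ])
  not-multiple {z} 1≤z z<m (k , eq) = contradiction (subst (λ w → 0≤ w - 1ℤ) z≡0 1≤z) λ ()
    where
    eq₁ : ∀ z m → z - 1ℤ + 1ℤ ≡ z - 0ℤ * m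
    eq₁ = solve-∀
    eq₂ : ∀ z m → m - 1ℤ - z ≡ 0ℤ * m + m - z - 1ℤ
    eq₂ = solve-∀
    eq₃ : ∀ k m → 0ℤ ≡ 0ℤ + k * m - k * m
    eq₃ = solve-∀
    eq₄ : ∀ k m z → z - 1ℤ + (m - 1ℤ - z) + 1ℤ ≡ k * m + m - (0ℤ + k * m) - 1ℤ
    eq₄ = solve-∀
    z≡0 : z ≡ 0ℤ
    z≡0 = trans eq (cong (λ w → 0ℤ + w * (+ m)) (sym (quotient-unique (0≤+ m) {z} {0ℤ} {k}
      (1≤z ⊕ 0≤+ 1 by eq₁ z (+ m)) (z<m by eq₂ z (+ m))
      (0≤+ 0 by trans (eq₃ k (+ m)) (cong (λ w → w - k * (+ m)) (sym eq)))
      ((1≤z ⊕ z<m) ⊕ 0≤+ 1 by trans (eq₄ k (+ m) z) (cong (λ w → k * + m + + m - w - 1ℤ) (sym eq))))))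

  near : ∀ {x} → ¬ (x ≈ 0ℤ [ + m ]) → ∃[ s ] ∃[ X ] s * s ≡ 1ℤ × s * x ≈ X [ + m ] × 0≤ X - 1ℤ × 0≤ + m - + 2 * X
  near {x} x≉0 with x %ℕ m | a≡a%ℕn+[a/ℕn]*n x m | n%ℕd<d x m
  ... | zero | x≡ | _ = contradiction (x /ℕ m , x≡) x≉0
  ... | suc r | x≡ | r<m with split ((+ m) - + 2 * + suc r)
  ...   | inj₁ 2r≤m = 1ℤ , + suc r , refl , (x /ℕ m , trans (ℤ.*-identityˡ x) x≡) , 0≤+ r , 2r≤m
  ...   | inj₂ 2r>m = - 1ℤ , (+ m) - + suc r , refl , (- (x /ℕ m) - 1ℤ , trans (cong (λ w → - 1ℤ * w) x≡)
            (eq₁ (+ suc r) (x /ℕ m) (+ m))) , diff< (+<+ r<m) , (2r>m ⊕ 0≤+ 1 by eq₂ (+ m) (+ suc r))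
    where
    eq₁ : ∀ r q m → - 1ℤ * (r + q * m) ≡ m - r + (- q - 1ℤ) * m
    eq₁ = solve-∀
    eq₂ : ∀ m r → - (m - + 2 * r) - 1ℤ + 1ℤ ≡ m - + 2 * (m - r)
    eq₂ = solve-∀

  scaled : ∀ {x s X} t → s * x ≈ X [ + m ] → t * s * x ≈ t * X [ + m ]
  scaled {x} {s} {X} t sx = ≈-trans (≈-reflexive (ℤ.*-assoc t s x)) (≈-scale t {s * x} {X} sx)

  -- Multiplication by - 2 folds the residues between m / 3 and m / 2 back below m / 3.
  reflected : ∀ {x s X} → s * x ≈ X [ + m ] → - (+ 2 * s) * x ≈ (+ m) - + 2 * X [ + m ]
  reflected {x} {s} {X} (k , eq) = - (+ 2 * k) - 1ℤ , trans (eq₁ s x) (trans (cong (λ w → - (+ 2 * w)) eq) (eq₂ X k (+ m)))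
    where
    eq₁ : ∀ s x → - (+ 2 * s) * x ≡ - (+ 2 * (s * x))
    eq₁ = solve-∀
    eq₂ : ∀ X k m → - (+ 2 * (X + k * m)) ≡ m - + 2 * X + (- (+ 2 * k) - 1ℤ) * m
    eq₂ = solve-∀

  Multiple : ℤ → (ℤ → Set) → Set
  Multiple x P = ∃[ s ] ∃[ X ] s * x ≈ X [ + m ] × P X

  -- Up to sign the residue is at most m / 2. If it is below m / 5, its multiples cannot jump over
  -- the interval from m / 5 to 2 m / 5.
  multiple-≥1/5 : ∀ {x} → ¬ (x ≈ 0ℤ [ + m ]) → Multiple x (λ X → 0≤ + 5 * X - + m × 0≤ + m - + 2 * X)
  multiple-≥1/5 {x} x≉0 with near x≉0
  ... | s , X , _ , sx , 1≤X , 2X≤m with split (+ 5 * X - (+ m))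
  ...   | inj₁ 5X≥m = s , X , sx , 5X≥m , 2X≤m
  ...   | inj₂ 5X<m with climb 5 1≤X (+ m)
  ...     | t , lo , hi = t * s , t * X , scaled {x} {s} {X} t sx , lo ,
              0≤-cancel 5 (2 ⊙ hi ⊕ 2 ⊙ 5X<m ⊕ 0≤+ 2 ⊕ 0≤+ m by eq (t * X) X (+ m))
    where
    eq : ∀ Y X m → + 2 * (m + + 5 * X - + 5 * Y) + + 2 * (- (+ 5 * X - m) - 1ℤ) + + 2 + m ≡ + 5 * (m - + 2 * Y)
    eq = solve-∀

  -- These are the lines on which a triangle has length at least m / 15: the length is 2 X - m / 3
  -- in the first range and X - m / 3 in the second. Multiplication by - 2 takes the gap between m /
  -- 3 and 2 m / 5 into the first range.
  axis-multiple : ∀ {x} → ¬ (x ≈ 0ℤ [ + m ]) → Multiple x (λ X →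
    0≤ + 5 * X - + m × 0≤ + m - + 3 * X ⊎ 0≤ + 5 * X - + 2 * + m × 0≤ + m - + 2 * X)
  axis-multiple {x} x≉0 with multiple-≥1/5 x≉0
  ... | s , X , sx , 5X≥m , 2X≤m with split ((+ m) - + 3 * X) | split (+ 5 * X - + 2 * (+ m))
  ...   | inj₁ 3X≤m | _ = s , X , sx , inj₁ (5X≥m , 3X≤m)
  ...   | inj₂ _ | inj₁ 5X≥2m = s , X , sx , inj₂ (5X≥2m , 2X≤m)
  ...   | inj₂ 3X>m | inj₂ 5X<2m = - (+ 2 * s) , (+ m) - + 2 * X , reflected {x} {s} {X} sx , inj₁
            ((2 ⊙ 5X<2m ⊕ 0≤+ 2 by eq₁ X (+ m)) , (2 ⊙ 3X>m ⊕ 0≤+ 2 by eq₂ X (+ m)))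
    where
    eq₁ : ∀ X m → + 2 * (- (+ 5 * X - + 2 * m) - 1ℤ) + + 2 ≡ + 5 * (m - + 2 * X) - m
    eq₁ = solve-∀
    eq₂ : ∀ X m → + 2 * (- (m - + 3 * X) - 1ℤ) + + 2 ≡ m - + 3 * (m - + 2 * X)
    eq₂ = solve-∀

  -- After folding by - 2 only X = m / 2 is left, which is sent to 0 and forces 2 w ≡ 0.
  multiple-≤1/3 : ∀ {w} → ¬ (w ≈ 0ℤ [ + m ]) → ¬ (+ 2 * w ≈ 0ℤ [ + m ]) →
    Multiple w (λ X → 0≤ X - 1ℤ × 0≤ + m - + 3 * X)
  multiple-≤1/3 {w} w≉0 2w≉0 with near w≉0
  ... | s , X , ss , sw , 1≤X , 2X≤m with split ((+ m) - + 3 * X)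
  ...   | inj₁ 3X≤m = s , X , sw , 1≤X , 3X≤m
  ...   | inj₂ 3X>m with split ((+ m) - + 2 * X - 1ℤ)
  ...     | inj₁ 2X<m = - (+ 2 * s) , (+ m) - + 2 * X , reflected {w} {s} {X} sw , 2X<m , (2 ⊙ 3X>m ⊕ 0≤+ 2 by eq₁ X (+ m))
    where
    eq₁ : ∀ X m → + 2 * (- (m - + 3 * X) - 1ℤ) + + 2 ≡ m - + 3 * (m - + 2 * X)
    eq₁ = solve-∀
  ...     | inj₂ 2X≥m = contradiction (≈-trans (≈-reflexive 2w≡)
              (≈-trans (≈-scale (- s) (≈-trans (reflected {w} {s} {X} sw)
                (≈-reflexive (sym (≤-antisym-0 (2X≤m by eq₄ (+ m) X) (2X≥m by eq₃ (+ m) X))))))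
                (≈-reflexive (ℤ.*-zeroʳ (- s))))) 2w≉0
    where
    eq₃ : ∀ m X → - (m - + 2 * X - 1ℤ) - 1ℤ ≡ 0ℤ - (m - + 2 * X)
    eq₃ = solve-∀
    eq₄ : ∀ m X → m - + 2 * X ≡ m - + 2 * X - 0ℤ
    eq₄ = solve-∀
    eq₂ : ∀ s w → - s * (- (+ 2 * s) * w) ≡ + 2 * (s * s * w)
    eq₂ = solve-∀
    2w≡ : + 2 * w ≡ - s * (- (+ 2 * s) * w)
    2w≡ = sym (trans (eq₂ s w) (cong (λ v → + 2 * v) (trans (cong (λ v → v * w) ss) (ℤ.*-identityˡ w))))

  -- On the line Y = X + W the coordinate X has a range of length W / 2 inside the triangle, so W ≥
  -- 2 m / 15 leaves room for a step of m / 15.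
  diagonal-multiple : ∀ {w} → ¬ (w ≈ 0ℤ [ + m ]) → ¬ (+ 2 * w ≈ 0ℤ [ + m ]) →
    Multiple w (λ W → 0≤ + 15 * W - + 2 * + m × 0≤ + m - + 3 * W)
  diagonal-multiple {w} w≉0 2w≉0 with multiple-≤1/3 w≉0 2w≉0
  ... | s , X , sw , 1≤X , 3X≤m with split (+ 15 * X - + 2 * (+ m))
  ...   | inj₁ 15X≥2m = s , X , sw , 15X≥2m , 3X≤m
  ...   | inj₂ 15X<2m with climb 15 1≤X (+ 2 * (+ m))
  ...     | t , lo , hi = t * s , t * X , scaled {w} {s} {X} t sw , lo ,
              0≤-cancel 5 (hi ⊕ 15X<2m ⊕ 0≤+ 1 ⊕ 0≤+ m by eq (t * X) X (+ m))
    where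
    eq : ∀ Y X m → + 2 * m + + 15 * X - + 15 * Y + (- (+ 15 * X - + 2 * m) - 1ℤ) + 1ℤ + m ≡ + 5 * (m - + 3 * Y)
    eq = solve-∀

  combined : ∀ {x j s X p} t → s * x ≈ X [ + m ] → j * x ≈ p [ + m ] → (s + t * j) * x ≈ X + t * p [ + m ]
  combined {x} {j} {s} {X} {p} t sx jx = ≈-trans (≈-reflexive (eq s t j x))
    (≈-+ {z = s * x} {w = X} {z′ = t * (j * x)} {w′ = t * p} sx (≈-scale t {j * x} {p} jx))
    where
    eq : ∀ s t j x → (s + t * j) * x ≡ s * x + t * (j * x)
    eq = solve-∀

  ≈0? : ∀ z → Dec (z ≈ 0ℤ [ + m ])
  ≈0? z with z %ℕ m in z%m | a≡a%ℕn+[a/ℕn]*n z m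
  ... | zero  | eq = yes (z /ℕ m , eq)
  ... | suc r | eq = no λ (k , eq′) →
        contradiction (trans (sym z%m) (%ℕ-unique {z} {k} m 0 (ℕ.>-nonZero⁻¹ m) eq′)) λ ()

  module _ {x y : ℤ} where

    -- Multiples of j move only the second coordinate, so X can be fixed first. The walk then stops
    -- just below Y = X + m / 3, the upper edge of the triangle, or, for X ≥ 2 m / 5, just below Y =
    -- m / 3, the upper edge of the mirrored one.
    axis-grid : ¬ (x ≈ 0ℤ [ + m ]) → ∀ j q .{{_ : NonZero q}} →
      j * x ≈ 0ℤ [ + m ] → j * y ≈ + q [ + m ] → 0≤ + m - + 15 * + q → Grid (+ m) x y
    axis-grid x≉0 j q jx jy 15q≤m = go (axis-multiple x≉0)
      where
      eq₀ : ∀ m X t → m - + 3 * X ≡ m - + 3 * (X + t * 0ℤ)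
      eq₀ = solve-∀
      eq₁ : ∀ m X Y t → m + + 3 * X - + 3 * Y ≡ m + + 3 * (X + t * 0ℤ) - + 3 * Y
      eq₁ = solve-∀
      eq₂ : ∀ m X Y t q → + 5 * (+ 3 * Y + + 3 * q - (m + + 3 * X)) + + 6 * (+ 5 * X - m) + (m - + 15 * q) ≡
                          + 5 * (+ 3 * (X + t * 0ℤ + Y) - + 2 * m)
      eq₂ = solve-∀
      eq₃ : ∀ m X Y t q → + 10 * (+ 3 * Y + + 3 * q - m) + + 2 * (m - + 15 * q) + + 15 * (m - + 2 * X) + + 3 * m ≡
                          + 10 * (m + + 3 * Y - + 3 * (X + t * 0ℤ))
      eq₃ = solve-∀
      eq₄ : ∀ m X Y t q → + 5 * (+ 3 * Y + + 3 * q - m) + + 3 * (+ 5 * X - + 2 * m) + (m - + 15 * q) ≡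
                          + 5 * (+ 3 * (Y + (X + t * 0ℤ)) - + 2 * m)
      eq₄ = solve-∀
      go : Multiple x (λ X → 0≤ + 5 * X - + m × 0≤ + m - + 3 * X ⊎
                             0≤ + 5 * X - + 2 * + m × 0≤ + m - + 2 * X) → Grid (+ m) x y
      go (s , X , sx , inj₁ (5X≥m , 3X≤m)) =
        let t , lo , hi = window q (s * y) (+ m + + 3 * X) in
        triangle-grid m (s + t * j) {x} {y} {X + t * 0ℤ} {s * y + t * + q}
              (combined {x} {j} {s} {X} {0ℤ} t sx jx)
              (combined {y} {j} {s} {s * y} {+ q} t (≈-reflexive refl) jy)
              (3X≤m by eq₀ (+ m) X t) (lo by eq₁ (+ m) X (s * y + t * + q) t)
              (0≤-cancel 5 (5 ⊙ hi ⊕ 6 ⊙ 5X≥m ⊕ 15q≤m by eq₂ (+ m) X (s * y + t * + q) t (+ q)))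
      go (s , X , sx , inj₂ (5X≥2m , 2X≤m)) =
        let t , lo , hi = window q (s * y) (+ m) in
        grid-swap {x = y} {x} (triangle-grid m (s + t * j) {y} {x} {s * y + t * + q} {X + t * 0ℤ}
              (combined {y} {j} {s} {s * y} {+ q} t (≈-reflexive refl) jy)
              (combined {x} {j} {s} {X} {0ℤ} t sx jx)
              lo (0≤-cancel 10 (10 ⊙ hi ⊕ 2 ⊙ 15q≤m ⊕ 15 ⊙ 2X≤m ⊕ 3 ⊙ 0≤+ m by eq₃ (+ m) X (s * y + t * + q) t (+ q)))
              (0≤-cancel 5 (5 ⊙ hi ⊕ 3 ⊙ 5X≥2m ⊕ 15q≤m by eq₄ (+ m) X (s * y + t * + q) t (+ q))))

    -- Steps along the diagonal keep Y - X, so the available lines are given by the multiples of y -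
    -- x. If 2 (y - x) ≡ 0, none of them is of use, and the pair (- x, y) is exceptional.
    diagonal-grid : Generic (+ m) x y → 10 ℕ.≤ m → ∀ j q .{{_ : NonZero q}} →
      j * x ≈ + q [ + m ] → j * y ≈ + q [ + m ] → 0≤ + m - + 15 * + q → Grid (+ m) x y
    diagonal-grid G 10≤m j q jx jy 15q≤m = go (≈0? (+ 2 * (- x + y)))
      where
      eq₀ : ∀ a b c → a + b + c ≡ a + c + b
      eq₀ = solve-∀
      eq₁ : ∀ m X W → m - + 3 * W ≡ m + + 3 * X - + 3 * (X + W)
      eq₁ = solve-∀
      eq₂ : ∀ m X W q → + 10 * (+ 3 * X + + 3 * q - m) + (+ 15 * W - + 2 * m) + + 2 * (m - + 15 * q) ≡
                        + 5 * (+ 3 * (X + (X + W)) - + 2 * m)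
      eq₂ = solve-∀
      eq₃ : ∀ s x y → s * y ≡ s * x + s * (- x + y)
      eq₃ = solve-∀
      sy : ∀ {s W} → s * (- x + y) ≈ W [ + m ] → s * y ≈ s * x + W [ + m ]
      sy {s} {W} (k , sw) = k , trans (eq₃ s x y) (trans (cong (λ v → s * x + v) sw) (sym (ℤ.+-assoc (s * x) W (k * + m))))
      offset : Multiple (- x + y) (λ W → 0≤ + 15 * W - + 2 * + m × 0≤ + m - + 3 * W) → Grid (+ m) x y
      offset (s , W , sw , 15W≥2m , 3W≤m) =
        let t , lo , hi = window q (s * x) (+ m) in
        triangle-grid m (s + t * j) {x} {y} {s * x + t * + q} {s * x + t * + q + W}
          (combined {x} {j} {s} {s * x} {+ q} t (≈-reflexive refl) jx)
          (≈-trans (combined {y} {j} {s} {s * x + W} {+ q} t (sy {s} {W} sw) jy) (≈-reflexive (eq₀ (s * x) W (t * + q))))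
          lo (3W≤m by eq₁ (+ m) (s * x + t * + q) W)
          (0≤-cancel 5 (10 ⊙ hi ⊕ 15W≥2m ⊕ 2 ⊙ 15q≤m by eq₂ (+ m) (s * x + t * + q) W (+ q)))
      go : Dec (+ 2 * (- x + y) ≈ 0ℤ [ + m ]) → Grid (+ m) x y
      go (yes 2w≈0) = grid-neg {x = x} {y}
        (exceptional-grid m 10≤m {x = - x} {y} (bézout₃ (generic-neg G)) 2w≈0 (-x+y≉0 G))
      go (no 2w≉0) = offset (diagonal-multiple (-x+y≉0 G) 2w≉0)

    -- For the direction (1, 2) the bounds of `slope-grid` read 8 ≤ 15 r ≤ 14 and admit no turn. The
    -- line through the origin, however, runs inside the triangle just before it reaches the corner
    -- (m / 3, 2 m / 3).
    double-grid : ∀ j p .{{_ : NonZero p}} →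
      j * x ≈ + p [ + m ] → j * y ≈ + 2 * + p [ + m ] → 0≤ + m - + 30 * + p → Grid (+ m) x y
    double-grid j p jx jy 30p≤m =
      let t , lo , hi = window p 0ℤ (+ m) in triangle-grid m (t * j) {x} {y} {t * + p} {t * (+ 2 * + p)}
          (scaled {x} {j} {+ p} t jx) (scaled {y} {j} {+ 2 * + p} t jy)
          (lo by eq₀ (+ m) t (+ p)) (lo by eq₁ (+ m) t (+ p))
          (0≤-cancel 10 (30 ⊙ hi ⊕ 3 ⊙ 30p≤m ⊕ 7 ⊙ 0≤+ m by eq₂ (+ m) t (+ p)))
      where
      eq₀ : ∀ m t p → m - + 3 * (0ℤ + t * p) ≡ m - + 3 * (t * p)
      eq₀ = solve-∀
      eq₁ : ∀ m t p → m - + 3 * (0ℤ + t * p) ≡ m + + 3 * (t * p) - + 3 * (t * (+ 2 * p))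
      eq₁ = solve-∀
      eq₂ : ∀ m t p → + 30 * (+ 3 * (0ℤ + t * p) + + 3 * p - m) + + 3 * (m - + 30 * p) + + 7 * m ≡
                      + 10 * (+ 3 * (t * p + t * (+ 2 * p)) - + 2 * m)
      eq₂ = solve-∀

    -- With r = p i − q k, the multiple t (p d , q d) meets the strip below
    -- Y = m / 3 on its i-th turn at a point (X , Y) with q X = p Y + r m.
    slope-grid : ∀ j d p q .{{_ : NonZero d}} .{{_ : NonZero q}} a b r →
      j * x ≈ + p * + d [ + m ] → j * y ≈ + q * + d [ + m ] → 0≤ + m - + 15 * (+ q * + d) →
      a * + p + b * + q ≡ 1ℤ → 0≤ + q - + p →
      0≤ + 15 * r - + 6 * + q + + 4 * + p → 0≤ + 9 * + q - + 4 * + p - + 15 * r → Grid (+ m) x y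
    slope-grid j d p q a b r jx jy 15q≤m bez p≤q r-lo r-hi =
      -- The translation by (r b m, - r a m) is trivial on the torus, and a p + b q = 1 makes it
      -- carry the line q X = p Y to q X = p Y + r m.
      let t , lo , hi = window (q ℕ.* d) {{ℕ.m*n≢0 q d}} (- (r * a * + m)) (+ m)
          lo′ = lo by cong (λ w → + m - + 3 * (- (r * a * + m) + t * w)) (ℤ.pos-* q d)
          hi′ = hi by cong (λ w → + 3 * (- (r * a * + m) + t * w) + + 3 * w - + m) (ℤ.pos-* q d)
          X   = - (- (r * b) * + m) + t * (+ p * + d)
          Y   = - (r * a * + m) + t * (+ q * + d)
      in grid-swap {x = y} {x} (triangle-grid m (t * j) {y} {x} {Y} {X}
           (≈-trans (scaled {y} {j} {+ q * + d} t jy) (r * a , eq₀ (t * (+ q * + d)) (r * a * + m)))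
           (≈-trans (scaled {x} {j} {+ p * + d} t jx) (- (r * b) , eq₀ (t * (+ p * + d)) (- (r * b) * + m)))
           lo′
           (upper X Y (QX (+ q) (+ p) (+ d) t r (+ m) bez) (15Y≥4m Y hi′))
           (lower X Y (QX (+ q) (+ p) (+ d) t r (+ m) bez) (15Y≥4m Y hi′)))
      where
      eq₀ : ∀ v w → v ≡ - w + v + w
      eq₀ = solve-∀
      QX : ∀ Q P D t r M → a * P + b * Q ≡ 1ℤ →
           Q * (- (- (r * b) * M) + t * (P * D)) ≡ P * (- (r * a * M) + t * (Q * D)) + r * M
      QX Q P D t r M bez = trans (eq₁ Q P D t r a b M)
        (trans (cong (λ w → P * (- (r * a * M) + t * (Q * D)) + r * w * M) bez) (eq₂ (P * (- (r * a * M) + t * (Q * D))) r M))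
        where
        eq₁ : ∀ Q P D t r a b M → Q * (- (- (r * b) * M) + t * (P * D)) ≡
              P * (- (r * a * M) + t * (Q * D)) + r * (a * P + b * Q) * M
        eq₁ = solve-∀
        eq₂ : ∀ z r M → z + r * 1ℤ * M ≡ z + r * M
        eq₂ = solve-∀
      -- The bounds on r place X between 6 m / 15 and 9 m / 15 at the lowest possible height Y = 4 m
      -- / 15. From there upwards X + Y grows and, since p ≤ q, X - Y does not, so both inequalities
      -- persist.
      15Y≥4m : ∀ Y → 0≤ + 3 * Y + + 3 * (+ q * + d) - + m → 0≤ + 15 * Y - + 4 * + m
      15Y≥4m Y hi = 5 ⊙ hi ⊕ 15q≤m by eq Y (+ q * + d) (+ m)
        where
        eq : ∀ Y q m → + 5 * (+ 3 * Y + + 3 * q - m) + (m - + 15 * q) ≡ + 15 * Y - + 4 * m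
        eq = solve-∀
      upper : ∀ X Y → + q * X ≡ + p * Y + r * + m → 0≤ + 15 * Y - + 4 * + m → 0≤ + m + + 3 * Y - + 3 * X
      upper X Y qX Y≥ = 0≤-cancel 5 (0≤-cancel q (p≤q ⊗ Y≥ ⊕ 0≤+ m ⊗ r-hi
        by trans (eq₁ (+ p) (+ q) Y r (+ m))
          (trans (cong (λ w → + 5 * + q * + m + + 15 * + q * Y - + 15 * w) (sym qX)) (eq₂ (+ q) Y X (+ m)))))
        where
        eq₁ : ∀ P Q Y r M → (Q - P) * (+ 15 * Y - + 4 * M) + M * (+ 9 * Q - + 4 * P - + 15 * r) ≡
              + 5 * Q * M + + 15 * Q * Y - + 15 * (P * Y + r * M)
        eq₁ = solve-∀
        eq₂ : ∀ Q Y X M → + 5 * Q * M + + 15 * Q * Y - + 15 * (Q * X) ≡ Q * (+ 5 * (M + + 3 * Y - + 3 * X))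
        eq₂ = solve-∀
      lower : ∀ X Y → + q * X ≡ + p * Y + r * + m → 0≤ + 15 * Y - + 4 * + m → 0≤ + 3 * (Y + X) - + 2 * + m
      lower X Y qX Y≥ = 0≤-cancel 5 (0≤-cancel q ((0≤+ p ⊕ 0≤+ q) ⊗ Y≥ ⊕ 0≤+ m ⊗ r-lo
        by trans (eq₁ (+ p) (+ q) Y r (+ m))
          (trans (cong (λ w → + 15 * + q * Y + + 15 * w - + 10 * + q * + m) (sym qX)) (eq₂ (+ q) Y X (+ m)))))
        where
        eq₁ : ∀ P Q Y r M → (P + Q) * (+ 15 * Y - + 4 * M) + M * (+ 15 * r - + 6 * Q + + 4 * P) ≡
              + 15 * Q * Y + + 15 * (P * Y + r * M) - + 10 * Q * M
        eq₁ = solve-∀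
        eq₂ : ∀ Q Y X M → + 15 * Q * Y + + 15 * (Q * X) - + 10 * Q * M ≡ Q * (+ 5 * (+ 3 * (Y + X) - + 2 * M))
        eq₂ = solve-∀

-- Large moduli: short steps and their directions

bézout : ∀ p q → ∃[ d ] d ∣ p × d ∣ q × ∃[ a ] ∃[ b ] a * + p + b * + q ≡ + d
bézout p q with Bézout.lemma p q
... | Bézout.result d g i = d , GCD.gcd∣m g , GCD.gcd∣n g , identity i
  where
  move : ∀ d {u v} → d ℕ.+ v ≡ u → + u - + v ≡ + d
  move d {u} {v} eq = trans (cong (λ w → + w - + v) (sym eq)) (eq₁ (+ d) (+ v))
    where
    eq₁ : ∀ d v → d + v - v ≡ d
    eq₁ = solve-∀
  eq₂ : ∀ a b p q → a * p + - b * q ≡ a * p - b * q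
  eq₂ = solve-∀
  eq₃ : ∀ a b p q → - a * p + b * q ≡ b * q - a * p
  eq₃ = solve-∀
  identity : Bézout.Identity d p q → ∃[ a ] ∃[ b ] a * + p + b * + q ≡ + d
  identity (Bézout.+- a b eq) = + a , - + b , trans (eq₂ (+ a) (+ b) (+ p) (+ q))
    (trans (sym (cong₂ _-_ (ℤ.pos-* a p) (ℤ.pos-* b q))) (move d eq))
  identity (Bézout.-+ a b eq) = - + a , + b , trans (eq₃ (+ a) (+ b) (+ p) (+ q))
    (trans (sym (cong₂ _-_ (ℤ.pos-* b q) (ℤ.pos-* a p))) (move d eq))

-- The range for r is the one slope-grid needs; its length is q / 5, so only
-- q < 5 has to be inspected.
turn : ∀ p q → 0 ℕ.< p → p ℕ.< q → ∀ a b → a * + p + b * + q ≡ 1ℤ → (p ≡ 1 × q ≡ 2) ⊎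
  (∃[ r ] 0≤ + 15 * r - + 6 * + q + + 4 * + p × 0≤ + 9 * + q - + 4 * + p - + 15 * r)
turn 1 1 _ (ℕ.s≤s ()) _ _ _
turn 1 2 _ _ _ _ _ = inj₁ (refl , refl)
turn 1 3 _ _ _ _ _ = inj₂ (1ℤ , 0≤+ _ , 0≤+ _)
turn 2 3 _ _ _ _ _ = inj₂ (1ℤ , 0≤+ _ , 0≤+ _)
turn 1 4 _ _ _ _ _ = inj₂ (+ 2 , 0≤+ _ , 0≤+ _)
turn 2 4 _ _ a b eq = contradiction (trans (eq₁ a b) eq) (even≢1 (a + b * + 2))
  where
  eq₁ : ∀ a b → (a + b * + 2) * + 2 ≡ a * + 2 + b * + 4
  eq₁ = solve-∀
turn 3 4 _ _ _ _ _ = inj₂ (1ℤ , 0≤+ _ , 0≤+ _)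
turn (suc (suc _)) 1 _ (ℕ.s≤s ()) _ _ _
turn (suc (suc _)) 2 _ (ℕ.s≤s (ℕ.s≤s ())) _ _ _
turn (suc (suc (suc _))) 3 _ (ℕ.s≤s (ℕ.s≤s (ℕ.s≤s ()))) _ _ _
turn (suc (suc (suc (suc _)))) 4 _ (ℕ.s≤s (ℕ.s≤s (ℕ.s≤s (ℕ.s≤s ())))) _ _ _
turn p (suc (suc (suc (suc (suc q′))))) _ _ _ _ _ =
  inj₂ (z /ℕ 15 , (/ℕ-upper z 15 ⊕ 3 ⊙ 0≤+ q′ ⊕ 0≤+ 1 by eq₁ (+ p) (+ q′) (z /ℕ 15)) ,
                  (/ℕ-lower z 15 by eq₂ (+ p) (+ q′) (z /ℕ 15)))
  where
  z = + 9 * (+ 5 + + q′) - + 4 * + p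
  eq₁ : ∀ p q r → r * + 15 + + 15 - (+ 9 * (+ 5 + q) - + 4 * p) - 1ℤ + + 3 * q + 1ℤ ≡ + 15 * r - + 6 * (+ 5 + q) + + 4 * p
  eq₁ = solve-∀
  eq₂ : ∀ p q r → + 9 * (+ 5 + q) - + 4 * p - r * + 15 ≡ + 9 * (+ 5 + q) - + 4 * p - + 15 * r
  eq₂ = solve-∀

module _ (m : ℕ) .{{_ : NonZero m}} (10≤m : 10 ℕ.≤ m) where

  Step : ℤ → ℤ → ℤ → ℤ → ℤ → Set
  Step x y j p q = j * x ≈ p [ + m ] × j * y ≈ q [ + m ]

  ordered-step-grid : ∀ {x y} → Generic (+ m) x y → ∀ j p q .{{_ : NonZero q}} → p ℕ.≤ q → Step x y j (+ p) (+ q) →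
    0≤ + m - + 15 * + q → Grid (+ m) x y
  ordered-step-grid {x} {y} G j zero q _ (jx , jy) 15q≤m = axis-grid m (x≉0 G) j q jx jy 15q≤m
  ordered-step-grid {x} {y} G j p@(suc p-1) q p≤q (jx , jy) 15q≤m = go (ℕ.m≤n⇒m<n∨m≡n p≤q)
    where
    sloped : p ℕ.< q → (∃[ d ] d ∣ p × d ∣ q × ∃[ a ] ∃[ b ] a * + p + b * + q ≡ + d) → Grid (+ m) x y
    sloped p<q (zero , divides u p≡ , _) = contradiction (trans p≡ (ℕ.*-zeroʳ u)) λ ()
    sloped p<q (d@(suc _) , divides u p≡ , divides v q≡ , a , b , bez) = use (turn u v u>0 u<v a b bez′)
      where
      ud : + p ≡ + u * + d
      ud = trans (cong +_ p≡) (ℤ.pos-* u d)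
      vd : + q ≡ + v * + d
      vd = trans (cong +_ q≡) (ℤ.pos-* v d)
      u>0 : 0 ℕ.< u
      u>0 = ℕ.n≢0⇒n>0 λ { refl → contradiction p≡ λ () }
      u<v : u ℕ.< v
      u<v = ℕ.*-cancelʳ-< d u v (subst₂ ℕ._<_ p≡ q≡ p<q)
      bez′ : a * + u + b * + v ≡ 1ℤ
      bez′ = ℤ.*-cancelʳ-≡ (a * + u + b * + v) 1ℤ (+ d) (trans (eq a b (+ u) (+ v) (+ d))
        (trans (cong₂ (λ s t → a * s + b * t) (sym ud) (sym vd)) (trans bez (sym (ℤ.*-identityˡ (+ d))))))
        where
        eq : ∀ a b u v d → (a * u + b * v) * d ≡ a * (u * d) + b * (v * d)
        eq = solve-∀
      use : (u ≡ 1 × v ≡ 2) ⊎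
        (∃[ r ] 0≤ + 15 * r - + 6 * + v + + 4 * + u × 0≤ + 9 * + v - + 4 * + u - + 15 * r) → Grid (+ m) x y
      use (inj₁ (refl , refl)) = double-grid m j d
        (subst (λ w → j * x ≈ w [ + m ]) (trans ud (ℤ.*-identityˡ (+ d))) jx)
        (subst (λ w → j * y ≈ w [ + m ]) vd jy)
        (15q≤m by trans (cong (λ w → + m - + 15 * w) vd) (eq (+ m) (+ d)))
        where
        eq : ∀ m d → m - + 15 * (+ 2 * d) ≡ m - + 30 * d
        eq = solve-∀
      use (inj₂ (r , lo , hi)) = slope-grid m j d u v {{_}} {{ℕ.>-nonZero (ℕ.<-trans u>0 u<v)}} a b r
        (subst (λ w → j * x ≈ w [ + m ]) ud jx)
        (subst (λ w → j * y ≈ w [ + m ]) vd jy)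
        (15q≤m by cong (λ w → + m - + 15 * w) vd) bez′ (diff (+≤+ (ℕ.<⇒≤ u<v))) lo hi
    go : p ℕ.< q ⊎ p ≡ q → Grid (+ m) x y
    go (inj₂ refl) = diagonal-grid m G 10≤m j q jx jy 15q≤m
    go (inj₁ p<q) = sloped p<q (bézout p q)

  step-gridℕ : ∀ {x y} → Generic (+ m) x y → ∀ j p q → ¬ (p ≡ 0 × q ≡ 0) → Step x y j (+ p) (+ q) →
    0≤ + m - + 15 * + p → 0≤ + m - + 15 * + q → Grid (+ m) x y
  step-gridℕ {x} {y} G j p q pq≢0 (jx , jy) 15p≤m 15q≤m = go (ℕ.≤-total p q)
    where
    go : p ℕ.≤ q ⊎ q ℕ.≤ p → Grid (+ m) x y
    go (inj₁ p≤q) = ordered-step-grid G j p q {{ℕ.≢-nonZero λ { refl → pq≢0 (ℕ.n≤0⇒n≡0 p≤q , refl) }}} p≤q (jx , jy) 15q≤m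
    go (inj₂ q≤p) = grid-swap {x = y} {x} (ordered-step-grid (generic-swap G) j q p
      {{ℕ.≢-nonZero λ { refl → pq≢0 (refl , ℕ.n≤0⇒n≡0 q≤p) }}} q≤p (jy , jx) 15p≤m)

  neg-step : ∀ j z {p} → j * z ≈ p [ + m ] → j * - z ≈ - p [ + m ]
  neg-step j z {p} (k , eq) = - k , trans (eq₁ j z) (trans (cong -_ eq) (eq₂ p k (+ m)))
    where
    eq₁ : ∀ j z → j * - z ≡ - (j * z)
    eq₁ = solve-∀
    eq₂ : ∀ p k m → - (p + k * m) ≡ - p + - k * m
    eq₂ = solve-∀

  Small : ℤ → Set
  Small p = 0≤ + m - + 15 * p × 0≤ + m - + 15 * - p

  step-grid : ∀ {x y} → Generic (+ m) x y → ∀ j p q → ¬ (p ≡ 0ℤ × q ≡ 0ℤ) → Step x y j p q → Small p → Small q → Grid (+ m) x y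
  step-grid G j (+ p) (+ q) pq≢0 jxy (p≤ , _) (q≤ , _) =
    step-gridℕ G j p q (λ (p≡0 , q≡0) → pq≢0 (cong +_ p≡0 , cong +_ q≡0)) jxy p≤ q≤
  step-grid {x} {y} G j -[1+ p ] (+ q) pq≢0 (jx , jy) (_ , p≤) (q≤ , _) =
    grid-neg {x = x} {y} (step-gridℕ (generic-neg G) j (suc p) q (λ ()) (neg-step j x jx , jy) p≤ q≤)
  step-grid {x} {y} G j (+ p) -[1+ q ] pq≢0 (jx , jy) (p≤ , _) (_ , q≤) =
    grid-swap {x = y} {x} (grid-neg {x = y} {x}
      (step-gridℕ (generic-neg (generic-swap G)) j (suc q) p (λ ()) (neg-step j y jy , jx) q≤ p≤))
  -- Here - j takes the place of j, and x and y keep their signs.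
  step-grid {x} {y} G j -[1+ p ] -[1+ q ] pq≢0 (jx , jy) (_ , p≤) (_ , q≤) =
    step-gridℕ G (- j) (suc p) (suc q) (λ ()) (neg-step′ j x jx , neg-step′ j y jy) p≤ q≤
    where
    neg-step′ : ∀ j z {p} → j * z ≈ p [ + m ] → - j * z ≈ - p [ + m ]
    neg-step′ j z {p} jz = ≈-trans (≈-reflexive (eq j z)) (neg-step j z jz)
      where
      eq : ∀ j z → - j * z ≡ j * - z
      eq = solve-∀

  -- Dirichlet: two of the points i (x , y), 0 ≤ i < m, share one of 15 × 15 boxes.
  module _ (225<m : 225 ℕ.< m) (x y : ℤ) where

    residue : ℤ → Fin m → ℕ
    residue z i = (+ toℕ i * z) %ℕ m

    box : ℤ → Fin m → Fin 15
    box z i = fromℕ< {(15 ℕ.* residue z i) ℕ./ m} (ℕ.m<n*o⇒m/o<n (ℕ.*-monoʳ-< 15 (n%ℕd<d (+ toℕ i * z) m)))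

    boxes : Fin m → Fin 225
    boxes i = Fin.combine {15} {15} (box x i) (box y i)

    box-≡ : ∀ {z i j} → box z i ≡ box z j → 0≤ + m - + 15 * (+ residue z i - + residue z j)
    box-≡ {z} {i} {j} eq = /ℕ-upper (+ (15 ℕ.* residue z i)) m ⊕ /ℕ-lower (+ (15 ℕ.* residue z j)) m ⊕ 0≤+ 1
      by trans (cong (λ w → + w * + m + + m - + (15 ℕ.* residue z i) - 1ℤ + (+ (15 ℕ.* residue z j) - Q j * + m) + 1ℤ) Q≡)
        (trans (cong₂ (λ v w → Q j * + m + + m - v - 1ℤ + (w - Q j * + m) + 1ℤ)
                 (ℤ.pos-* 15 (residue z i)) (ℤ.pos-* 15 (residue z j)))
          (eq₁ (Q j * + m) (+ m) (+ residue z i) (+ residue z j)))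
      where
      Q : Fin m → ℤ
      Q i = + ((15 ℕ.* residue z i) ℕ./ m)
      Q≡ : (15 ℕ.* residue z i) ℕ./ m ≡ (15 ℕ.* residue z j) ℕ./ m
      Q≡ = trans (sym (Fin.toℕ-fromℕ< _)) (trans (cong toℕ eq) (Fin.toℕ-fromℕ< _))
      eq₁ : ∀ Q m r s → Q + m - + 15 * r - 1ℤ + (+ 15 * s - Q) + 1ℤ ≡ m - + 15 * (r - s)
      eq₁ = solve-∀

    difference : ∀ z i i′ → (+ toℕ i′ - + toℕ i) * z ≈ + residue z i′ - + residue z i [ + m ]
    difference z i i′ = q′ - q , trans (eq₁ (+ toℕ i′) (+ toℕ i) z)
      (trans (cong₂ _-_ (a≡a%ℕn+[a/ℕn]*n (+ toℕ i′ * z) m) (a≡a%ℕn+[a/ℕn]*n (+ toℕ i * z) m))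
        (eq₂ (+ residue z i′) (+ residue z i) q′ q (+ m)))
      where
      q  = (+ toℕ i * z) /ℕ m
      q′ = (+ toℕ i′ * z) /ℕ m
      eq₁ : ∀ a b z → (a - b) * z ≡ a * z - b * z
      eq₁ = solve-∀
      eq₂ : ∀ r s q′ q m → r + q′ * m - (s + q * m) ≡ r - s + (q′ - q) * m
      eq₂ = solve-∀

    small-step : ∃[ j ] ∃[ p ] ∃[ q ] ¬ (j ≈ 0ℤ [ + m ]) × Step x y j p q × Small p × Small q
    small-step = found (Fin.pigeonhole 225<m boxes)
      where
      small : ∀ {z i i′} → box z i ≡ box z i′ → Small (+ residue z i′ - + residue z i)
      small {z} {i} {i′} eq = box-≡ {z} {i′} {i} (sym eq) ,
        (box-≡ {z} {i} {i′} eq by eq₁ (+ m) (+ residue z i) (+ residue z i′))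
        where
        eq₁ : ∀ m r s → m - + 15 * (r - s) ≡ m - + 15 * - (s - r)
        eq₁ = solve-∀
      found : (∃[ i ] ∃[ i′ ] i Fin.< i′ × boxes i ≡ boxes i′) →
        ∃[ j ] ∃[ p ] ∃[ q ] ¬ (j ≈ 0ℤ [ + m ]) × Step x y j p q × Small p × Small q
      found (i , i′ , i<i′ , eq) = + toℕ i′ - + toℕ i , _ , _ ,
        not-multiple m (diff< (+<+ i<i′)) (diff< (+<+ (Fin.toℕ<n i′)) ⊕ 0≤+ (toℕ i) by eq₁ (+ m) (+ toℕ i) (+ toℕ i′)) ,
        (difference x i i′ , difference y i i′) ,
        small {x} {i} {i′} (proj₁ boxes-≡) , small {y} {i} {i′} (proj₂ boxes-≡)
        where
        boxes-≡ = Fin.combine-injective (box x i) (box y i) (box x i′) (box y i′) eq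
        eq₁ : ∀ m i i′ → m - i′ - 1ℤ + i ≡ m - 1ℤ - (i′ - i)
        eq₁ = solve-∀

  large-grid : 225 ℕ.< m → ∀ {x y} → Generic (+ m) x y → Grid (+ m) x y
  large-grid 225<m {x} {y} G =
    let j , p , q , j≉0 , (jx , jy) , p-small , q-small = small-step 225<m x y
    -- If p and q both vanished, m would divide j x and j y, hence also j by Bézout.
    in step-grid G j p q (λ (p≡0 , q≡0) → j≉0 (unit (bézout₃ G)
         (subst (λ w → j * x ≈ w [ + m ]) p≡0 jx) (subst (λ w → j * y ≈ w [ + m ]) q≡0 jy))) (jx , jy) p-small q-small
    where
    eq₁ : ∀ α β γ x y m j → j * (α * x + β * y + γ * m) ≡ α * (j * x) + β * (j * y) + γ * j * m
    eq₁ = solve-∀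
    eq₂ : ∀ α β k l n m → α * (0ℤ + k * m) + β * (0ℤ + l * m) + n * m ≡ 0ℤ + (α * k + β * l + n) * m
    eq₂ = solve-∀
    unit : Bézout₃ (+ m) x y → ∀ {j} → j * x ≈ 0ℤ [ + m ] → j * y ≈ 0ℤ [ + m ] → j ≈ 0ℤ [ + m ]
    unit (α , β , γ , bez) {j} (k , jx) (l , jy) = α * k + β * l + γ * j , trans (sym (ℤ.*-identityʳ j))
      (trans (cong (λ w → j * w) (sym bez)) (trans (eq₁ α β γ x y (+ m) j)
        (trans (cong₂ (λ v w → α * v + β * w + γ * j * + m) jx jy) (eq₂ α β k l (γ * j) (+ m)))))

-- Moduli from 36 to 225

∧-elim : ∀ a {b} → T (a ∧ b) → T a × T b
∧-elim true p = tt , p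

∨-elim : ∀ a {b} → T (a ∨ b) → T a ⊎ T b
∨-elim true  p = inj₁ tt
∨-elim false p = inj₂ p

allBelow anyBelow : ℕ → (ℕ → Bool) → Bool
allBelow zero    f = true
allBelow (suc n) f = f n ∧ allBelow n f
anyBelow zero    f = false
anyBelow (suc n) f = f n ∨ anyBelow n f

allBelow-sound : ∀ n f → T (allBelow n f) → ∀ {i} → i ℕ.< n → T (f i)
allBelow-sound (suc n) f p {i} (ℕ.s≤s i≤n) with ∧-elim (f n) p | ℕ.m≤n⇒m<n∨m≡n i≤n
... | _ , q | inj₁ i<n  = allBelow-sound n f q i<n
... | q , _ | inj₂ refl = q

anyBelow-sound : ∀ n f → T (anyBelow n f) → ∃[ i ] T (f i)
anyBelow-sound (suc n) f p with ∨-elim (f n) p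
... | inj₁ q = n , q
... | inj₂ q = anyBelow-sound n f q

-- The value at modulus 0 is a default that keeps the Boolean searches free of `NonZero` arguments;
-- their ranges include g n = 0.
remainder : ℕ → ℕ → ℕ
remainder zero    z = z
remainder (suc m) z = z ℕ.% suc m

remainder-≈ : ∀ m .{{_ : NonZero m}} z → + z ≈ + remainder m z [ + m ]
remainder-≈ m@(suc _) z = + (z ℕ./ m) , a≡a%ℕn+[a/ℕn]*n (+ z) m

_divides?_ : ℕ → ℕ → Bool
m divides? z = remainder m z ≡ᵇ 0

divides?-sound : ∀ m .{{_ : NonZero m}} z → T (m divides? z) → + z ≈ 0ℤ [ + m ]
divides?-sound m z p = subst (λ r → + z ≈ + r [ + m ]) (ℕ.≡ᵇ⇒≡ (remainder m z) 0 p) (remainder-≈ m z)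

inTriangle : ℕ → ℕ → ℕ → Bool
inTriangle m X Y = (3 ℕ.* X ≤ᵇ m) ∧ (3 ℕ.* Y ≤ᵇ m ℕ.+ 3 ℕ.* X) ∧ (2 ℕ.* m ≤ᵇ 3 ℕ.* (X ℕ.+ Y))

inTriangle-sound : ∀ m X Y → T (inTriangle m X Y) →
  0≤ + m - + 3 * + X × 0≤ + m + + 3 * + X - + 3 * + Y × 0≤ + 3 * (+ X + + Y) - + 2 * + m
inTriangle-sound m X Y p with ∧-elim (3 ℕ.* X ≤ᵇ m) p
... | p₁ , p′ with ∧-elim (3 ℕ.* Y ≤ᵇ m ℕ.+ 3 ℕ.* X) p′
...   | p₂ , p₃ =
  (diff (+≤+ (ℕ.≤ᵇ⇒≤ (3 ℕ.* X) m p₁)) by cong (λ w → + m - w) (ℤ.pos-* 3 X)) ,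
  (diff (+≤+ (ℕ.≤ᵇ⇒≤ (3 ℕ.* Y) (m ℕ.+ 3 ℕ.* X) p₂)) by cong₂ (λ v w → + m + v - w) (ℤ.pos-* 3 X) (ℤ.pos-* 3 Y)) ,
  (diff (+≤+ (ℕ.≤ᵇ⇒≤ (2 ℕ.* m) (3 ℕ.* (X ℕ.+ Y)) p₃)) by cong₂ (λ v w → v - w) (ℤ.pos-* 3 (X ℕ.+ Y)) (ℤ.pos-* 2 m))

inTriangles : ℕ → ℕ → ℕ → Bool
inTriangles m X Y = inTriangle m X Y ∨ inTriangle m Y X

-- The lattice spanned by (g , e) and (0 , n), in ℤ² modulo m = g n.
latticeHit : ℕ → ℕ → ℕ → ℕ → ℕ → Bool
latticeHit g n e k t = inTriangles (g ℕ.* n) (k ℕ.* g) (remainder (g ℕ.* n) (k ℕ.* e ℕ.+ t ℕ.* n))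

-- Points of both triangles have their first coordinate between 0 and 2 m / 3.
latticePoint : ℕ → ℕ → ℕ → Bool
latticePoint g n e = anyBelow (suc (2 ℕ.* n ℕ./ 3)) λ k → anyBelow g (latticeHit g n e k)

-- The cases are x ≡ 0, y ≡ 0, 2 (x + y) ≡ 0 and 2 (x - y) ≡ 0, tested on the generators (g , e) and
-- (0 , n). The first two contradict genericity, the others are exceptional.
latticeDegenerate : ℕ → ℕ → ℕ → ℕ → Bool
latticeDegenerate m g n e = (n ≡ᵇ 1) ∨ (m divides? e ∧ m divides? n) ∨
  (m divides? (2 ℕ.* n) ∧ (m divides? (2 ℕ.* (g ℕ.+ e)) ∨ (remainder m (2 ℕ.* g) ≡ᵇ remainder m (2 ℕ.* e))))

latticeOK : ℕ → ℕ → ℕ → Bool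
latticeOK g n e = latticePoint g n e ∨ latticeDegenerate (g ℕ.* n) g n e

indexOK : ℕ → ℕ → ℕ → ℕ → Bool
indexOK lo hi g n = (g ℕ.* n <ᵇ lo) ∨ (hi <ᵇ g ℕ.* n) ∨ allBelow n (latticeOK g n)

latticesOK : ℕ → ℕ → Bool
latticesOK lo hi = allBelow (suc hi) λ g → allBelow (suc hi) (indexOK lo hi g)

Lattice : ℕ → ℕ → ℕ → Set
Lattice g n e = T (latticePoint g n e) ⊎ T (latticeDegenerate (g ℕ.* n) g n e)

lattice-cases : ∀ lo hi → latticesOK lo hi ≡ true → ∀ g n e → lo ℕ.≤ g ℕ.* n → g ℕ.* n ℕ.≤ hi →
  0 ℕ.< g → e ℕ.< n → Lattice g n e
lattice-cases lo hi ok g n e lo≤ ≤hi 0<g e<n = index (∨-elim (g ℕ.* n <ᵇ lo) checked)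
  where
  g≤ : g ℕ.≤ hi
  g≤ = ℕ.≤-trans (ℕ.m≤m*n g n {{ℕ.>-nonZero (ℕ.≤-<-trans ℕ.z≤n e<n)}}) ≤hi
  n≤ : n ℕ.≤ hi
  n≤ = ℕ.≤-trans (ℕ.m≤n*m n g {{ℕ.>-nonZero 0<g}}) ≤hi
  checked : T (indexOK lo hi g n)
  checked = allBelow-sound (suc hi) (indexOK lo hi g)
    (allBelow-sound (suc hi) (λ g → allBelow (suc hi) (indexOK lo hi g)) (subst T (sym ok) tt) (ℕ.s≤s g≤)) (ℕ.s≤s n≤)
  lattice : T (hi <ᵇ g ℕ.* n) ⊎ T (allBelow n (latticeOK g n)) → Lattice g n e
  lattice (inj₁ p) = contradiction (ℕ.<ᵇ⇒< hi (g ℕ.* n) p) (ℕ.≤⇒≯ ≤hi)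
  lattice (inj₂ p) = ∨-elim (latticePoint g n e) (allBelow-sound n (latticeOK g n) p e<n)
  index : T (g ℕ.* n <ᵇ lo) ⊎ T ((hi <ᵇ g ℕ.* n) ∨ allBelow n (latticeOK g n)) → Lattice g n e
  index (inj₁ p) = contradiction (ℕ.<ᵇ⇒< (g ℕ.* n) lo p) (ℕ.≤⇒≯ lo≤)
  index (inj₂ p) = lattice (∨-elim (hi <ᵇ g ℕ.* n) p)

module _ (m : ℕ) .{{_ : NonZero m}} {x y : ℤ} (g n e : ℕ) (m≡ : m ≡ g ℕ.* n) (j₁ j₂ : ℤ)
         (j₁x : j₁ * x ≈ + g [ + m ]) (j₁y : j₁ * y ≈ + e [ + m ])
         (j₂x : j₂ * x ≈ 0ℤ [ + m ]) (j₂y : j₂ * y ≈ + n [ + m ]) where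

  lattice-point : ∀ k t → (+ k * j₁ + + t * j₂) * x ≈ + (k ℕ.* g) [ + m ] ×
                          (+ k * j₁ + + t * j₂) * y ≈ + remainder m (k ℕ.* e ℕ.+ t ℕ.* n) [ + m ]
  lattice-point k t =
    ≈-trans (combined m {x} {j₂} {+ k * j₁} {+ k * + g} {0ℤ} (+ t) (scaled m {x} {j₁} {+ g} (+ k) j₁x) j₂x)
      (≈-reflexive (trans (eq (+ k * + g) (+ t)) (sym (ℤ.pos-* k g)))) ,
    ≈-trans (combined m {y} {j₂} {+ k * j₁} {+ k * + e} {+ n} (+ t) (scaled m {y} {j₁} {+ e} (+ k) j₁y) j₂y)
      (≈-trans (≈-reflexive (sym (cong₂ _+_ (ℤ.pos-* k e) (ℤ.pos-* t n)))) (remainder-≈ m (k ℕ.* e ℕ.+ t ℕ.* n)))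
    where
    eq : ∀ a t → a + t * 0ℤ ≡ a
    eq = solve-∀

  point-grid : T (latticePoint g n e) → Grid (+ m) x y
  point-grid p =
    let k , p′ = anyBelow-sound (suc (2 ℕ.* n ℕ./ 3)) (λ k → anyBelow g (latticeHit g n e k)) p
        t , p″ = anyBelow-sound g (latticeHit g n e k) p′
    in go k t (subst (λ m → T (inTriangles m (k ℕ.* g) (remainder m (k ℕ.* e ℕ.+ t ℕ.* n)))) (sym m≡) p″)
    where
    go : ∀ k t → T (inTriangles m (k ℕ.* g) (remainder m (k ℕ.* e ℕ.+ t ℕ.* n))) → Grid (+ m) x y
    go k t p = use (∨-elim (inTriangle m X Y) p)
      where
      X = k ℕ.* g
      Y = remainder m (k ℕ.* e ℕ.+ t ℕ.* n)
      j = + k * j₁ + + t * j₂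
      use : T (inTriangle m X Y) ⊎ T (inTriangle m Y X) → Grid (+ m) x y
      use (inj₁ q) = let jx , jy = lattice-point k t ; h₁ , h₂ , h₃ = inTriangle-sound m X Y q in
        triangle-grid m j {x} {y} {+ X} {+ Y} jx jy h₁ h₂ h₃
      use (inj₂ q) = let jx , jy = lattice-point k t ; h₁ , h₂ , h₃ = inTriangle-sound m Y X q in
        grid-swap {x = y} {x} (triangle-grid m j {y} {x} {+ Y} {+ X} jy jx h₁ h₂ h₃)

module _ (m : ℕ) .{{_ : NonZero m}} (10≤m : 10 ℕ.≤ m) {x y : ℤ} (G : Generic (+ m) x y)
         (g n e : ℕ) (m≡ : m ≡ g ℕ.* n) (x′ κ : ℤ)
         (x≡ : x ≡ x′ * + g) (y≡ : y ≡ x′ * + e + κ * + n) where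

  spanned : ∀ c z w → + c * w ≈ 0ℤ [ + m ] → + c * + n ≈ 0ℤ [ + m ] → z ≡ x′ * w + κ * + n → + c * z ≈ 0ℤ [ + m ]
  spanned c z w cw cn z≡ = ≈-trans (≈-reflexive (trans (cong (λ v → + c * v) z≡) (eq₁ (+ c) x′ w κ (+ n))))
    (≈-trans (≈-+ (≈-scale x′ cw) (≈-scale κ cn)) (≈-reflexive (eq₂ x′ κ)))
    where
    eq₁ : ∀ c x′ w κ n → c * (x′ * w + κ * n) ≡ x′ * (c * w) + κ * (c * n)
    eq₁ = solve-∀
    eq₂ : ∀ a b → a * 0ℤ + b * 0ℤ ≡ 0ℤ
    eq₂ = solve-∀

  degenerate-grid : T (latticeDegenerate m g n e) → Grid (+ m) x y
  degenerate-grid p with ∨-elim (n ≡ᵇ 1) p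
  ... | inj₁ n≡1 = contradiction (x′ , trans x≡ (trans (cong (λ w → x′ * + w) g≡m) (sym (ℤ.+-identityˡ (x′ * + m))))) (x≉0 G)
    where
    g≡m : g ≡ m
    g≡m = sym (trans m≡ (trans (cong (g ℕ.*_) (ℕ.≡ᵇ⇒≡ n 1 n≡1)) (ℕ.*-identityʳ g)))
  ... | inj₂ p′ with ∨-elim (m divides? e ∧ m divides? n) p′
  ...   | inj₁ q = let q₁ , q₂ = ∧-elim (m divides? e) q in
          contradiction (≈-trans (≈-reflexive (sym (ℤ.*-identityˡ y))) (spanned 1 y (+ e)
            (≈-trans (≈-reflexive (ℤ.*-identityˡ (+ e))) (divides?-sound m e q₁))
            (≈-trans (≈-reflexive (ℤ.*-identityˡ (+ n))) (divides?-sound m n q₂)) y≡)) (y≉0 G)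
  ...   | inj₂ q with ∧-elim (m divides? (2 ℕ.* n)) q
  ...     | q₁ , q₂ = go (∨-elim (m divides? (2 ℕ.* (g ℕ.+ e))) q₂)
    where
    2n≈0 : + 2 * + n ≈ 0ℤ [ + m ]
    2n≈0 = ≈-trans (≈-reflexive (sym (ℤ.pos-* 2 n))) (divides?-sound m (2 ℕ.* n) q₁)
    eq₁ : ∀ x′ g e v → x′ * g + (x′ * e + v) ≡ x′ * (g + e) + v
    eq₁ = solve-∀
    eq₂ : ∀ x′ g e v → - (x′ * g) + (x′ * e + v) ≡ x′ * (- g + e) + v
    eq₂ = solve-∀
    eq₃ : ∀ g e → + 2 * (- g + e) ≡ + 2 * e + - 1ℤ * (+ 2 * g)
    eq₃ = solve-∀
    eq₄ : ∀ r → r + - 1ℤ * r ≡ 0ℤ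
    eq₄ = solve-∀
    rem-≈ : ∀ z → + 2 * + z ≈ + remainder m (2 ℕ.* z) [ + m ]
    rem-≈ z = ≈-trans (≈-reflexive (sym (ℤ.pos-* 2 z))) (remainder-≈ m (2 ℕ.* z))
    go : T (m divides? (2 ℕ.* (g ℕ.+ e))) ⊎ T (remainder m (2 ℕ.* g) ≡ᵇ remainder m (2 ℕ.* e)) → Grid (+ m) x y
    go (inj₁ r) = exceptional-grid m 10≤m (bézout₃ G) (spanned 2 (x + y) (+ g + + e)
      (≈-trans (≈-reflexive (sym (ℤ.pos-* 2 (g ℕ.+ e)))) (divides?-sound m (2 ℕ.* (g ℕ.+ e)) r)) 2n≈0
      (trans (cong₂ _+_ x≡ y≡) (eq₁ x′ (+ g) (+ e) (κ * + n)))) (x+y≉0 G)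
    go (inj₂ r) = grid-neg {x = x} {y} (exceptional-grid m 10≤m (bézout₃ (generic-neg G)) (spanned 2 (- x + y) (- + g + + e)
      (≈-trans (≈-reflexive (eq₃ (+ g) (+ e))) (≈-trans (≈-+ (rem-≈ e)
        (≈-scale (- 1ℤ) (subst (λ w → + 2 * + g ≈ + w [ + m ])
          (ℕ.≡ᵇ⇒≡ (remainder m (2 ℕ.* g)) (remainder m (2 ℕ.* e)) r) (rem-≈ g))))
        (≈-reflexive (eq₄ (+ remainder m (2 ℕ.* e)))))) 2n≈0
      (trans (cong₂ (λ v w → - v + w) x≡ y≡) (eq₂ x′ (+ g) (+ e) (κ * + n)))) (-x+y≉0 G))

abstract
  lattices-checked : latticesOK 36 225 ≡ true
  lattices-checked = refl

-- By coprimality (b , y) has order m in (ℤ / m)², so with m ℤ² it spans a lattice of index m. Its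
-- Hermite normal form has the rows (g , e) and (0 , n) with g = gcd (b, m), n = m / g and e < n.
-- Thus the check meets one case per lattice instead of m² pairs.
medium-grid : ∀ m → 36 ℕ.≤ m → m ℕ.≤ 225 → ∀ b y → Generic (+ m) (+ b) y → Grid (+ m) (+ b) y
medium-grid m 36≤m m≤225 b y G = go (bézout b m)
  where
  go : (∃[ d ] d ∣ b × d ∣ m × ∃[ a ] ∃[ c ] a * + b + c * + m ≡ + d) → Grid (+ m) (+ b) y
  go (g , divides x′ b≡ , divides n m≡ , a , c , bez) =
    let α , β , γ , bez₃ = bézout₃ G in lattice α β γ bez₃
    where
    gn : m ≡ g ℕ.* n
    gn = trans m≡ (ℕ.*-comm n g)
    instance
      m≢0 : NonZero m
      m≢0 = ℕ.>-nonZero (ℕ.≤-trans (ℕ.s≤s ℕ.z≤n) 36≤m)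
      g≢0 : NonZero g
      g≢0 = ℕ.≢-nonZero λ { refl → ℕ.≢-nonZero⁻¹ m gn }
      n≢0 : NonZero n
      n≢0 = ℕ.≢-nonZero λ { refl → ℕ.≢-nonZero⁻¹ m m≡ }
    e = (a * y) %ℕ n
    s = (a * y) /ℕ n
    ay≡ : a * y ≡ + e + s * + n
    ay≡ = a≡a%ℕn+[a/ℕn]*n (a * y) n
    B≡ : + b ≡ + x′ * + g
    B≡ = trans (cong +_ b≡) (ℤ.pos-* x′ g)
    M≡ : + m ≡ + n * + g
    M≡ = trans (cong +_ m≡) (ℤ.pos-* n g)
    bez′ : a * + x′ + c * + n ≡ 1ℤ
    bez′ = ℤ.*-cancelʳ-≡ (a * + x′ + c * + n) 1ℤ (+ g) (trans (eq a c (+ x′) (+ n) (+ g))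
      (trans (cong₂ (λ v w → a * v + c * w) (sym B≡) (sym M≡)) (trans bez (sym (ℤ.*-identityˡ (+ g))))))
      where
      eq : ∀ a c x n g → (a * x + c * n) * g ≡ a * (x * g) + c * (n * g)
      eq = solve-∀
    y≡ : y ≡ + x′ * + e + (+ x′ * s + c * y) * + n
    y≡ = trans (sym (ℤ.*-identityˡ y)) (trans (cong (λ w → w * y) (sym bez′)) (trans (eq₁ a (+ x′) c (+ n) y)
      (trans (cong (λ w → + x′ * w + c * y * + n) ay≡) (eq₂ (+ x′) (+ e) s (+ n) (c * y)))))
      where
      eq₁ : ∀ a x c n y → (a * x + c * n) * y ≡ x * (a * y) + c * y * n
      eq₁ = solve-∀
      eq₂ : ∀ x e s n v → x * (e + s * n) + v * n ≡ x * e + (x * s + v) * n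
      eq₂ = solve-∀
    lattice : ∀ α β γ → α * + b + β * y + γ * + m ≡ 1ℤ → Grid (+ m) (+ b) y
    lattice α β γ bez₃ = use (lattice-cases 36 225 lattices-checked g n e (subst (36 ℕ.≤_) gn 36≤m) (subst (ℕ._≤ 225) gn m≤225)
      (ℕ.>-nonZero⁻¹ g) (n%ℕd<d (a * y) n))
      where
      -- As n b ≡ 0, the factor n kills b, and it turns β y ≡ 1 - α b into n. Subtracting s times
      -- this multiple reduces a y to e.
      j₂ = β * + n
      j₁ = a + - s * j₂
      j₂x : j₂ * + b ≈ 0ℤ [ + m ]
      j₂x = β * + x′ , trans (cong (λ w → β * + n * w) B≡)
        (trans (eq β (+ n) (+ x′) (+ g)) (cong (λ w → 0ℤ + β * + x′ * w) (sym M≡)))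
        where
        eq : ∀ β n x g → β * n * (x * g) ≡ 0ℤ + β * x * (n * g)
        eq = solve-∀
      j₂y : j₂ * y ≈ + n [ + m ]
      j₂y = - (α * + x′ + γ * + n) , trans (eq₁ β (+ n) y α (+ b) γ (+ m))
        (trans (cong₂ (λ v w → + n * v - + n * w) bez₃ (cong₂ (λ v w → α * v + γ * w) B≡ M≡))
          (trans (eq₂ (+ n) α (+ x′) (+ g) γ) (cong (λ w → + n + - (α * + x′ + γ * + n) * w) (sym M≡))))
        where
        eq₁ : ∀ β n y α b γ m → β * n * y ≡ n * (α * b + β * y + γ * m) - n * (α * b + γ * m)
        eq₁ = solve-∀
        eq₂ : ∀ n α x g γ → n * 1ℤ - n * (α * (x * g) + γ * (n * g)) ≡ n + - (α * x + γ * n) * (n * g)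
        eq₂ = solve-∀
      ax : a * + b ≈ + g [ + m ]
      ax = - c , trans (eq (a * + b) c (+ m)) (cong (λ w → w + - c * + m) bez)
        where
        eq : ∀ v c m → v ≡ v + c * m + - c * m
        eq = solve-∀
      j₁x : j₁ * + b ≈ + g [ + m ]
      j₁x = ≈-trans (combined m {+ b} {j₂} {a} {+ g} {0ℤ} (- s) ax j₂x) (≈-reflexive (eq (+ g) s))
        where
        eq : ∀ g s → g + - s * 0ℤ ≡ g
        eq = solve-∀
      j₁y : j₁ * y ≈ + e [ + m ]
      j₁y = ≈-trans (combined m {y} {j₂} {a} {+ e + s * + n} {+ n} (- s) (≈-reflexive ay≡) j₂y) (≈-reflexive (eq (+ e) s (+ n)))
        where
        eq : ∀ e s n → e + s * n + - s * n ≡ e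
        eq = solve-∀
      10≤m : 10 ℕ.≤ m
      10≤m = ℕ.≤-trans (ℕ.m≤m+n 10 26) 36≤m
      use : Lattice g n e → Grid (+ m) (+ b) y
      use (inj₁ p) = point-grid m g n e gn j₁ j₂ j₁x j₁y j₂x j₂y p
      use (inj₂ p) = degenerate-grid m 10≤m G g n e gn (+ x′) (+ x′ * s + c * y) B≡ y≡
        (subst (λ m → T (latticeDegenerate m g n e)) (sym gn) p)

colourable-↭ : ∀ {S S′} → S ↭ S′ → Colourable S → Colourable S′
colourable-↭ S↭S′ (χ , cover) = χ , λ n k → Any-resp-↭ S↭S′ (cover n k)

Triple : ℕ → ℕ → ℕ → Set
Triple a b c = Colourable (0ℤ ∷ + a ∷ + b ∷ + c ∷ [])

-- Moduli up to 35

module _ {N} .{{_ : NonZero N}} (w : Vec (Fin 3) N) where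

  letter : ℕ → Fin 3
  letter r = lookup w (r ℕ.mod N)

  Covers : List ℕ → Set
  Covers S = ∀ (r : Fin N) k → Any (λ s → letter (toℕ r ℕ.+ s) ≡ k) S

  covers? : ∀ S → Dec (Covers S)
  covers? S = Fin.all? λ r → Fin.all? λ k → Any.any? (λ s → letter (toℕ r ℕ.+ s) Fin.≟ k) S

  periodic-word : ∀ S → {_ : True (covers? S)} → Colourable (map +_ S)
  periodic-word S {ok} = (λ n → letter (n %ℕ N)) , λ n k →
    Any.map⁺ (Any.map (λ {s} h → trans (shift n s) h) (toWitness ok (fromℕ< (n%ℕd<d n N)) k))
    where
    shift : ∀ n s → letter ((n + + s) %ℕ N) ≡ letter (toℕ (fromℕ< (n%ℕd<d n N)) ℕ.+ s)
    shift n s = cong (lookup w) (Fin.toℕ-injective (trans (Fin.toℕ-fromℕ< _) (trans (cong (ℕ._% N) shifted)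
      (trans (ℕ.m%n%n≡m%n _ N) (sym (Fin.toℕ-fromℕ< _))))))
      where
      r = toℕ (fromℕ< (n%ℕd<d n N))
      shifted : (n + + s) %ℕ N ≡ (r ℕ.+ s) ℕ.% N
      shifted = %ℕ-unique {q = + ((r ℕ.+ s) ℕ./ N) + n /ℕ N} N ((r ℕ.+ s) ℕ.% N) (ℕ.m%n<n (r ℕ.+ s) N)
        (trans (cong (λ w → w + + s) (trans (a≡a%ℕn+[a/ℕn]*n n N)
                 (cong (λ w → + w + n /ℕ N * + N) (sym (Fin.toℕ-fromℕ< (n%ℕd<d n N))))))
          (trans (eq₁ (+ r) (n /ℕ N * + N) (+ s)) (trans (cong (λ w → w + n /ℕ N * + N) (a≡a%ℕn+[a/ℕn]*n (+ (r ℕ.+ s)) N))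
            (eq₂ (+ ((r ℕ.+ s) ℕ.% N)) (+ ((r ℕ.+ s) ℕ./ N)) (n /ℕ N) (+ N)))))
        where
        eq₁ : ∀ r p s → r + p + s ≡ r + s + p
        eq₁ = solve-∀
        eq₂ : ∀ r p q N → r + p * N + q * N ≡ r + (p + q) * N
        eq₂ = solve-∀

triple-1-7-9 : Triple 1 7 9
triple-1-7-9 = periodic-word
  (0F ∷ 0F ∷ 0F ∷ 1F ∷ 0F ∷ 0F ∷ 1F ∷ 1F ∷ 1F ∷ 2F ∷ 2F ∷ 1F ∷ 2F ∷ 2F ∷ 2F ∷ []) (0 ∷ 1 ∷ 7 ∷ 9 ∷ [])

-- This set is the mirror image 9 - {0, 1, 7, 9}, and its word is the previous one reversed.
triple-2-8-9 : Triple 2 8 9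
triple-2-8-9 = periodic-word
  (2F ∷ 2F ∷ 2F ∷ 1F ∷ 2F ∷ 2F ∷ 1F ∷ 1F ∷ 1F ∷ 0F ∷ 0F ∷ 1F ∷ 0F ∷ 0F ∷ 0F ∷ []) (0 ∷ 2 ∷ 8 ∷ 9 ∷ [])

gaps : ℕ → ℕ → ℕ → ℕ → Bool
gaps N P Q R = (3 ℕ.* P ≤ᵇ N) ∧ (3 ℕ.* Q ≤ᵇ N ℕ.+ 3 ℕ.* P) ∧ (3 ℕ.* R ≤ᵇ N ℕ.+ 3 ℕ.* Q) ∧ (2 ℕ.* N ≤ᵇ 3 ℕ.* R)

gapsBy : ℕ → ℕ → ℕ → ℕ → ℕ → Bool
gapsBy N j a b c = gaps N (remainder N (j ℕ.* a)) (remainder N (j ℕ.* b)) (remainder N (j ℕ.* c))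

-- `gaps` expects the points in one order around the circle, and multiplication by j may produce any
-- of the six.
spreadBy : ℕ → ℕ → ℕ → ℕ → ℕ → Bool
spreadBy a b c N j = gapsBy N j a b c ∨ gapsBy N j a c b ∨ gapsBy N j b a c ∨
                     gapsBy N j b c a ∨ gapsBy N j c a b ∨ gapsBy N j c b a

-- As anyBelow counts down from i = 31, the circles are tried in the order of
-- their lengths 3, 4, …, 34.
spreads : ℕ → ℕ → ℕ → ℕ → Bool
spreads a b c i = anyBelow (suc (34 ℕ.∸ i)) (spreadBy a b c (suc (33 ℕ.∸ i)))

-- For m = b + c - a, both a ≡ b + c and c - b lie strictly between 0 and m, so 2 (b ± c) ≡ 0 means
-- 2 a = m or 2 (c - b) = m. The bound 10 is 2 h for h = 5.
halfModulus : ℕ → ℕ → ℕ → ℕ → Bool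
halfModulus m a b c = (10 ≤ᵇ m) ∧ ((2 ℕ.* a ≡ᵇ m) ∨ (2 ℕ.* c ≡ᵇ m ℕ.+ 2 ℕ.* b))

same : ℕ → ℕ → ℕ → ℕ → ℕ → ℕ → Bool
same a b c a′ b′ c′ = (a ≡ᵇ a′) ∧ (b ≡ᵇ b′) ∧ (c ≡ᵇ c′)

sporadic : ℕ → ℕ → ℕ → Bool
sporadic a b c = same a b c 1 7 9 ∨ same a b c 2 8 9

even³ : ℕ → ℕ → ℕ → Bool
even³ a b c = (2 divides? a) ∧ (2 divides? b) ∧ (2 divides? c)

smallOK : ℕ → ℕ → ℕ → Bool
smallOK c b a = (35 <ᵇ b ℕ.+ c ℕ.∸ a) ∨ halfModulus (b ℕ.+ c ℕ.∸ a) a b c ∨ sporadic a b c ∨ even³ a b c ∨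
  anyBelow 32 (spreads a b c)

smallsOK : ℕ → Bool
smallsOK hi = allBelow hi λ c → allBelow c λ b → allBelow b λ { zero → true ; a@(suc _) → smallOK c b a }

abstract
  smalls-checked : smallsOK 35 ≡ true
  smalls-checked = refl

small-check : ∀ hi → smallsOK hi ≡ true → ∀ {a b c} → 0 ℕ.< a → a ℕ.< b → b ℕ.< c → c ℕ.< hi → T (smallOK c b a)
small-check hi ok {suc a} {b} {c} _ a<b b<c c<hi =
  allBelow-sound b _ (allBelow-sound c _ (allBelow-sound hi _ (subst T (sym ok) tt) c<hi) b<c) a<b

≤ᵇ-sound : ∀ {u v} U V → + u ≡ U → + v ≡ V → T (u ≤ᵇ v) → 0≤ V - U
≤ᵇ-sound {u} {v} _ _ refl refl p = diff (+≤+ (ℕ.≤ᵇ⇒≤ u v p))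

gaps-sound : ∀ N .{{_ : NonZero N}} P Q R → T (gaps N P Q R) → Colourable[ + N ] (0ℤ ∷ + P ∷ + Q ∷ + R ∷ [])
gaps-sound N P Q R p =
  let p₁ , q₁ = ∧-elim (3 ℕ.* P ≤ᵇ N) p
      p₂ , q₂ = ∧-elim (3 ℕ.* Q ≤ᵇ N ℕ.+ 3 ℕ.* P) q₁
      p₃ , p₄ = ∧-elim (3 ℕ.* R ≤ᵇ N ℕ.+ 3 ℕ.* Q) q₂
  in arc-colouring N {+ P} {+ Q} {+ R}
       (≤ᵇ-sound (+ 3 * + P) (+ N) (ℤ.pos-* 3 P) refl p₁)
       (≤ᵇ-sound (+ 3 * + Q) (+ N + + 3 * + P) (ℤ.pos-* 3 Q) (cong (λ w → + N + w) (ℤ.pos-* 3 P)) p₂)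
       (≤ᵇ-sound (+ 3 * + R) (+ N + + 3 * + Q) (ℤ.pos-* 3 R) (cong (λ w → + N + w) (ℤ.pos-* 3 Q)) p₃)
       (≤ᵇ-sound (+ 2 * + N) (+ 3 * + R) (ℤ.pos-* 2 N) (ℤ.pos-* 3 R) p₄)

ordered-sound : ∀ N .{{_ : NonZero N}} j a b c →
  T (gapsBy N j a b c) → Triple a b c
ordered-sound N j a b c h =
  let χ , _ , cover = pull-back (+ j) (≈-remainder a) (≈-remainder b) (≈-remainder c)
                        (gaps-sound N (remainder N (j ℕ.* a)) (remainder N (j ℕ.* b)) (remainder N (j ℕ.* c)) h)
  in χ , cover
  where
  ≈-remainder : ∀ z → + j * + z ≈ + remainder N (j ℕ.* z) [ + N ]
  ≈-remainder z = ≈-trans (≈-reflexive (sym (ℤ.pos-* j z))) (remainder-≈ N (j ℕ.* z))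

swap₁₂ : ∀ {a b c} → Triple a b c → Triple b a c
swap₁₂ = colourable-↭ (prep _ (swap _ _ ↭-refl))

swap₂₃ : ∀ {a b c} → Triple a b c → Triple a c b
swap₂₃ = colourable-↭ (prep _ (prep _ (swap _ _ ↭-refl)))

spread-sound : ∀ N .{{_ : NonZero N}} j a b c → T (spreadBy a b c N j) → Triple a b c
spread-sound N j a b c p with ∨-elim (gapsBy N j a b c) p
... | inj₁ h = ordered-sound N j a b c h
... | inj₂ p with ∨-elim (gapsBy N j a c b) p
...   | inj₁ h = swap₂₃ {a} {c} {b} (ordered-sound N j a c b h)
...   | inj₂ p with ∨-elim (gapsBy N j b a c) p
...     | inj₁ h = swap₁₂ {b} {a} {c} (ordered-sound N j b a c h)
...     | inj₂ p with ∨-elim (gapsBy N j b c a) p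
...       | inj₁ h = swap₁₂ {b} {a} {c} (swap₂₃ {b} {c} {a} (ordered-sound N j b c a h))
...       | inj₂ p with ∨-elim (gapsBy N j c a b) p
...         | inj₁ h = swap₂₃ {a} {c} {b} (swap₁₂ {c} {a} {b} (ordered-sound N j c a b h))
...         | inj₂ h = swap₁₂ {b} {a} {c} (swap₂₃ {b} {c} {a} (swap₁₂ {c} {b} {a} (ordered-sound N j c b a h)))

same-sound : ∀ a b c a′ b′ c′ → T (same a b c a′ b′ c′) → Triple a′ b′ c′ → Triple a b c
same-sound a b c a′ b′ c′ p t with ∧-elim (a ≡ᵇ a′) p
... | p₁ , q with ∧-elim (b ≡ᵇ b′) q
...   | p₂ , p₃ rewrite ℕ.≡ᵇ⇒≡ a a′ p₁ | ℕ.≡ᵇ⇒≡ b b′ p₂ | ℕ.≡ᵇ⇒≡ c c′ p₃ = t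

Coprime : ℕ → ℕ → ℕ → Set
Coprime a b c = ∃[ u ] ∃[ v ] ∃[ w ] u * + a + v * + b + w * + c ≡ 1ℤ

even³-sound : ∀ a b c → T (even³ a b c) → ¬ Coprime a b c
even³-sound a b c p (u , v , w , cop) with ∧-elim (2 divides? a) p
... | p₁ , q with ∧-elim (2 divides? b) q
...   | p₂ , p₃ with divides?-sound 2 a p₁ | divides?-sound 2 b p₂ | divides?-sound 2 c p₃
...     | k , a≡ | l , b≡ | n , c≡ = even≢1 (u * k + v * l + w * n) (trans (eq u v w k l n)
            (trans (cong₂ (λ x y → u * x + v * y + w * (0ℤ + n * + 2)) (sym a≡) (sym b≡))
              (trans (cong (λ x → u * + a + v * + b + w * x) (sym c≡)) cop)))
  where
  eq : ∀ u v w k l n → (u * k + v * l + w * n) * + 2 ≡ u * (0ℤ + k * + 2) + v * (0ℤ + l * + 2) + w * (0ℤ + n * + 2)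
  eq = solve-∀

-- Coprime triples: genericity and the three ranges of the modulus

module _ {a b c : ℕ} (0<a : 0 ℕ.< a) (a<b : a ℕ.< b) (b<c : b ℕ.< c) (coprime : Coprime a b c) where

  modulus : ℕ
  modulus = b ℕ.+ c ℕ.∸ a

  modulus≡ : + modulus ≡ + b + + c - + a
  modulus≡ = trans (sym (ℤ.⊖-≥ a≤)) (sym (ℤ.m-n≡m⊖n (b ℕ.+ c) a))
    where
    a≤ : a ℕ.≤ b ℕ.+ c
    a≤ = ℕ.≤-trans (ℕ.<⇒≤ a<b) (ℕ.m≤m+n b c)

  private
    1≤A : 0≤ + a - 1ℤ
    1≤A = diff (+≤+ 0<a)
    A<B : 0≤ + b - + a - 1ℤ
    A<B = diff< (+<+ a<b)
    B<C : 0≤ + c - + b - 1ℤ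
    B<C = diff< (+<+ b<c)

  -- This is a < b in disguise. It bounds c in the finite check for small moduli.
  c<modulus : c ℕ.< modulus
  c<modulus = ℤ.drop‿+<+ (ℤ.suc[i]≤j⇒i<j (ℤ.0≤i-j⇒j≤i
    (A<B by trans (eq (+ a) (+ b) (+ c)) (cong (λ m → m - (1ℤ + + c)) (sym modulus≡)))))
    where
    eq : ∀ a b c → b - a - 1ℤ ≡ b + c - a - (1ℤ + c)
    eq = solve-∀

  instance
    modulus≢0 : NonZero modulus
    modulus≢0 = ℕ.>-nonZero (ℕ.≤-<-trans ℕ.z≤n c<modulus)

  a≉0 : ¬ (+ a ≈ 0ℤ [ + modulus ])
  a≉0 = not-multiple modulus 1≤A
    (2 ⊙ A<B ⊕ B<C ⊕ 0≤+ 2 by trans (eq (+ a) (+ b) (+ c)) (cong (λ m → m - 1ℤ - + a) (sym modulus≡)))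
    where
    eq : ∀ a b c → + 2 * (b - a - 1ℤ) + (c - b - 1ℤ) + + 2 ≡ b + c - a - 1ℤ - a
    eq = solve-∀

  generic : Generic (+ modulus) (+ b) (+ c)
  generic = record
    -- Substituting a = b + c - m turns a combination of a, b, c into one of b, c, m.
    { bézout₃ = let u , v , w , eq = coprime in u + v , u + w , - u ,
        trans (cong (λ m → (u + v) * + b + (u + w) * + c + - u * m) modulus≡) (trans (eq₁ u v w (+ a) (+ b) (+ c)) eq)
    ; x≉0     = not-multiple modulus (1≤A ⊕ A<B ⊕ 0≤+ 1 by eq₂ (+ a) (+ b))
        (A<B ⊕ B<C ⊕ 0≤+ 1 by trans (eq₃ (+ a) (+ b) (+ c)) (cong (λ m → m - 1ℤ - + b) (sym modulus≡)))
    ; y≉0     = not-multiple modulus (1≤A ⊕ A<B ⊕ B<C ⊕ 0≤+ 2 by eq₄ (+ a) (+ b) (+ c))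
        (A<B by trans (eq₅ (+ a) (+ b) (+ c)) (cong (λ m → m - 1ℤ - + c) (sym modulus≡)))
    ; x+y≉0   = λ (k , eq) → a≉0 (k - 1ℤ ,
        trans (eq₆ (+ a) (+ b) (+ c)) (trans (cong₂ _-_ eq (sym modulus≡)) (eq₇ k (+ modulus))))
    ; -x+y≉0  = not-multiple modulus (B<C by eq₈ (+ b) (+ c))
        (2 ⊙ A<B ⊕ 1≤A ⊕ 0≤+ 2 by trans (eq₉ (+ a) (+ b) (+ c)) (cong (λ m → m - 1ℤ - (- + b + + c)) (sym modulus≡)))
    }
    where
    eq₁ : ∀ u v w a b c → (u + v) * b + (u + w) * c + - u * (b + c - a) ≡ u * a + v * b + w * c
    eq₁ = solve-∀
    eq₂ : ∀ a b → a - 1ℤ + (b - a - 1ℤ) + 1ℤ ≡ b - 1ℤ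
    eq₂ = solve-∀
    eq₃ : ∀ a b c → b - a - 1ℤ + (c - b - 1ℤ) + 1ℤ ≡ b + c - a - 1ℤ - b
    eq₃ = solve-∀
    eq₄ : ∀ a b c → a - 1ℤ + (b - a - 1ℤ) + (c - b - 1ℤ) + + 2 ≡ c - 1ℤ
    eq₄ = solve-∀
    eq₅ : ∀ a b c → b - a - 1ℤ ≡ b + c - a - 1ℤ - c
    eq₅ = solve-∀
    eq₆ : ∀ a b c → a ≡ b + c - (b + c - a)
    eq₆ = solve-∀
    eq₇ : ∀ k m → 0ℤ + k * m - m ≡ 0ℤ + (k - 1ℤ) * m
    eq₇ = solve-∀
    eq₈ : ∀ b c → c - b - 1ℤ ≡ - b + c - 1ℤ
    eq₈ = solve-∀
    eq₉ : ∀ a b c → + 2 * (b - a - 1ℤ) + (a - 1ℤ) + + 2 ≡ b + c - a - 1ℤ - (- b + c)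
    eq₉ = solve-∀

  from-grid : Grid (+ modulus) (+ b) (+ c) → Triple a b c
  from-grid grid = grid⇒colourable {+ a} {+ b} {+ c} (subst (λ m → Grid m (+ b) (+ c)) modulus≡ grid)

  half-modulus : T (halfModulus modulus a b c) → Grid (+ modulus) (+ b) (+ c)
  half-modulus p with ∧-elim (10 ≤ᵇ modulus) p
  ... | 10≤ᵇm , q = go (∨-elim (2 ℕ.* a ≡ᵇ modulus) q)
    where
    10≤m = ℕ.≤ᵇ⇒≤ 10 modulus 10≤ᵇm
    go : T (2 ℕ.* a ≡ᵇ modulus) ⊎ T (2 ℕ.* c ≡ᵇ modulus ℕ.+ 2 ℕ.* b) → Grid (+ modulus) (+ b) (+ c)
    go (inj₁ h) = exceptional-grid modulus 10≤m (Generic.bézout₃ generic)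
      (+ 3 , trans (eq₁ (+ a) (+ b) (+ c)) (trans (cong₂ (λ v w → v + + 2 * w) (sym (ℤ.pos-* 2 a)) (sym modulus≡))
        (trans (cong (λ v → + v + + 2 * + modulus) (ℕ.≡ᵇ⇒≡ (2 ℕ.* a) modulus h)) (eq₂ (+ modulus)))))
      (Generic.x+y≉0 generic)
      where
      eq₁ : ∀ a b c → + 2 * (b + c) ≡ + 2 * a + + 2 * (b + c - a)
      eq₁ = solve-∀
      eq₂ : ∀ m → m + + 2 * m ≡ 0ℤ + + 3 * m
      eq₂ = solve-∀
    go (inj₂ h) = grid-neg {x = + b} {+ c} (exceptional-grid modulus 10≤m (Generic.bézout₃ (generic-neg generic))
      (1ℤ , trans (eq₁ (+ b) (+ c)) (trans (cong (λ v → v - + 2 * + b) (trans (sym (ℤ.pos-* 2 c))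
        (trans (cong +_ (ℕ.≡ᵇ⇒≡ (2 ℕ.* c) (modulus ℕ.+ 2 ℕ.* b) h)) (cong (λ w → + modulus + w) (ℤ.pos-* 2 b)))))
        (eq₂ (+ modulus) (+ 2 * + b))))
      (Generic.-x+y≉0 generic))
      where
      eq₁ : ∀ b c → + 2 * (- b + c) ≡ + 2 * c - + 2 * b
      eq₁ = solve-∀
      eq₂ : ∀ m v → m + v - v ≡ 0ℤ + 1ℤ * m
      eq₂ = solve-∀

  small-triple : modulus ℕ.≤ 35 → Triple a b c
  small-triple m≤35 = go₁ (∨-elim (35 <ᵇ modulus)
    (small-check 35 smalls-checked 0<a a<b b<c (ℕ.<-≤-trans c<modulus m≤35)))
    where
    go₅ : T (anyBelow 32 (spreads a b c)) → Triple a b c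
    go₅ p = let i , p′ = anyBelow-sound 32 (spreads a b c) p
                j , p″ = anyBelow-sound (suc (34 ℕ.∸ i)) (spreadBy a b c (suc (33 ℕ.∸ i))) p′
            in spread-sound (suc (33 ℕ.∸ i)) j a b c p″
    go₄ : T (even³ a b c) ⊎ T (anyBelow 32 (spreads a b c)) → Triple a b c
    go₄ (inj₁ p) = contradiction coprime (even³-sound a b c p)
    go₄ (inj₂ p) = go₅ p
    go₃ : T (sporadic a b c) ⊎ T (even³ a b c ∨ anyBelow 32 (spreads a b c)) → Triple a b c
    go₃ (inj₂ p) = go₄ (∨-elim (even³ a b c) p)
    go₃ (inj₁ p) with ∨-elim (same a b c 1 7 9) p
    ... | inj₁ q = same-sound a b c 1 7 9 q triple-1-7-9
    ... | inj₂ q = same-sound a b c 2 8 9 q triple-2-8-9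
    go₂ : T (halfModulus modulus a b c) ⊎ T (sporadic a b c ∨ even³ a b c ∨ anyBelow 32 (spreads a b c)) → Triple a b c
    go₂ (inj₁ p) = from-grid (half-modulus p)
    go₂ (inj₂ p) = go₃ (∨-elim (sporadic a b c) p)
    go₁ : T (35 <ᵇ modulus) ⊎
          T (halfModulus modulus a b c ∨ sporadic a b c ∨ even³ a b c ∨ anyBelow 32 (spreads a b c)) → Triple a b c
    go₁ (inj₁ p) = contradiction (ℕ.<ᵇ⇒< 35 modulus p) (ℕ.≤⇒≯ m≤35)
    go₁ (inj₂ p) = go₂ (∨-elim (halfModulus modulus a b c) p)

  coprime-triple : Triple a b c
  coprime-triple with modulus ℕ.≤? 35 | modulus ℕ.≤? 225
  ... | yes m≤35 | _         = small-triple m≤35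
  ... | no m≰35  | yes m≤225 = from-grid (medium-grid modulus (ℕ.≰⇒> m≰35) m≤225 b (+ c) generic)
  ... | no _     | no m≰225  = from-grid (large-grid modulus (ℕ.≤-trans (ℕ.m≤m+n 10 216) (ℕ.≰⇒> m≰225)) (ℕ.≰⇒> m≰225) generic)

-- From coprime triples to arbitrary four-element sets

triple : ∀ {a b c} → 0 ℕ.< a → a ℕ.< b → b ℕ.< c → Triple a b c
triple {a} {b} {c} 0<a a<b b<c = go (bézout a b)
  where
  go : (∃[ d ] d ∣ a × d ∣ b × ∃[ u ] ∃[ v ] u * + a + v * + b ≡ + d) → Triple a b c
  go (d , d∣a , d∣b , u , v , uv≡d) = go′ (bézout d c)
    where
    go′ : (∃[ e ] e ∣ d × e ∣ c × ∃[ s ] ∃[ w ] s * + d + w * + c ≡ + e) → Triple a b c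
    go′ (e , e∣d , divides c′ c≡ , s , w , sw≡e) = reduced (∣-trans e∣d d∣a) (∣-trans e∣d d∣b)
      where
      reduced : e ∣ a → e ∣ b → Triple a b c
      reduced (divides a′ a≡) (divides b′ b≡) =
        subst Colourable (cong₂ _∷_ (ℤ.*-zeroʳ (+ e)) (cong₂ _∷_ (part a≡) (cong₂ _∷_ (part b≡) (cong (_∷ []) (part c≡)))))
          (scale-colourable e (coprime-triple 0<a′ (cancel a≡ b≡ a<b) (cancel b≡ c≡ b<c) coprime))
        where
        part : ∀ {z z′} → z ≡ z′ ℕ.* e → + e * + z′ ≡ + z
        part {z} {z′} eq = trans (ℤ.*-comm (+ e) (+ z′)) (trans (sym (ℤ.pos-* z′ e)) (cong +_ (sym eq)))
        cancel : ∀ {z z′ y y′} → z ≡ z′ ℕ.* e → y ≡ y′ ℕ.* e → z ℕ.< y → z′ ℕ.< y′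
        cancel {z′ = z′} {y′ = y′} z≡ y≡ z<y = ℕ.*-cancelʳ-< e z′ y′ (subst₂ ℕ._<_ z≡ y≡ z<y)
        0<a′ : 0 ℕ.< a′
        0<a′ = cancel {z = 0} {z′ = 0} refl a≡ 0<a
        instance
          e≢0 : NonZero e
          e≢0 = ℕ.≢-nonZero λ { refl → ℕ.<⇒≢ 0<a (sym (trans a≡ (ℕ.*-zeroʳ a′))) }
        eq₁ : ∀ s u v w a b c e → (s * u * a + s * v * b + w * c) * e ≡ s * (u * (e * a) + v * (e * b)) + w * (e * c)
        eq₁ = solve-∀
        coprime : Coprime a′ b′ c′
        coprime = s * u , s * v , w , ℤ.*-cancelʳ-≡ (s * u * + a′ + s * v * + b′ + w * + c′) 1ℤ (+ e)
          (trans (eq₁ s u v w (+ a′) (+ b′) (+ c′) (+ e))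
            (trans (cong₂ (λ x y → s * (u * x + v * y) + w * (+ e * + c′)) (part a≡) (part b≡))
              (trans (cong₂ (λ x y → s * x + w * y) uv≡d (part c≡)) (trans sw≡e (sym (ℤ.*-identityˡ (+ e)))))))

sorted-colourable : ∀ {s₀ s₁ s₂ s₃} → s₀ ℤ.< s₁ → s₁ ℤ.< s₂ → s₂ ℤ.< s₃ → Colourable (s₀ ∷ s₁ ∷ s₂ ∷ s₃ ∷ [])
sorted-colourable {s₀} {s₁} {s₂} {s₃} s₀<s₁ s₁<s₂ s₂<s₃ =
  subst Colourable (cong₂ _∷_ (ℤ.+-identityʳ s₀) (cong₂ _∷_ (part s₀<s₁)
    (cong₂ _∷_ (part s₀<s₂) (cong (_∷ []) (part (ℤ.<-trans s₀<s₂ s₂<s₃))))))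
    (translate-colourable s₀ (triple
      (ℤ.drop‿+<+ (subst₂ ℤ._<_ (ℤ.+-inverseʳ s₀) (sym (distance s₀<s₁)) (ℤ.+-monoˡ-< (- s₀) s₀<s₁)))
      (mono s₀<s₁ s₀<s₂ s₁<s₂) (mono s₀<s₂ (ℤ.<-trans s₀<s₂ s₂<s₃) s₂<s₃)))
  where
  s₀<s₂ = ℤ.<-trans s₀<s₁ s₁<s₂
  distance : ∀ {s} → s₀ ℤ.< s → + ℤ.∣ s - s₀ ∣ ≡ s - s₀
  distance s₀<s = ℤ.0≤i⇒+∣i∣≡i (diff (ℤ.<⇒≤ s₀<s))
  part : ∀ {s} → s₀ ℤ.< s → s₀ + + ℤ.∣ s - s₀ ∣ ≡ s
  part {s} s₀<s = trans (cong (λ w → s₀ + w) (distance s₀<s)) (eq s₀ s)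
    where
    eq : ∀ t s → t + (s - t) ≡ s
    eq = solve-∀
  mono : ∀ {s s′} → s₀ ℤ.< s → s₀ ℤ.< s′ → s ℤ.< s′ → ℤ.∣ s - s₀ ∣ ℕ.< ℤ.∣ s′ - s₀ ∣
  mono p p′ s<s′ = ℤ.drop‿+<+ (subst₂ ℤ._<_ (sym (distance p)) (sym (distance p′)) (ℤ.+-monoˡ-< (- s₀) s<s′))

distinct-colourable : ∀ S → length S ≡ 4 → AllPairs _≢_ S → Colourable S
distinct-colourable S len distinct = colourable-↭ (sort-↭ S) (go (sort S) (trans (↭-length (sort-↭ S)) len)
  (AllPairs-resp-↭ (λ x≢y → x≢y ∘ sym) ((λ { refl p → p }) , (λ { refl p → p })) (↭⇒↭ₛ (↭-sym (sort-↭ S))) distinct)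
  (sort-↗ S))
  where
  go : ∀ L → length L ≡ 4 → AllPairs _≢_ L → Linked ℤ._≤_ L → Colourable L
  go (_ ∷ _ ∷ _ ∷ _ ∷ []) refl ((≢₁ ∷ _) ∷ (≢₂ ∷ _) ∷ (≢₃ ∷ _) ∷ _) (≤₁ ∷ ≤₂ ∷ ≤₃ ∷ [-]) =
    sorted-colourable (ℤ.≤∧≢⇒< ≤₁ ≢₁) (ℤ.≤∧≢⇒< ≤₂ ≢₂) (ℤ.≤∧≢⇒< ≤₃ ≢₃)

theorem1 : ∀ {ℓ : Level} (S : Pred ℤ ℓ) → HasCardinality S 4 →
    let open Polychromatic +-0-abelianGroup in
    HasPolychromaticColoring S 3 × (∀ (p : ℕ) → IsPolychromaticNumber S p → 3 ≤ p)
theorem1 S (f , f-injective , S⇔f) = coloring , λ p (_ , maximal) → maximal 3 coloring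
  where
  open Polychromatic +-0-abelianGroup
  coloring : HasPolychromaticColoring S 3
  coloring =
    let χ , cover = distinct-colourable (tabulate f) refl (AllPairs.tabulate⁺ (λ i≢j → i≢j ∘ f-injective))
    in record { to = χ ; cong = cong χ } , λ n k →
         let i , hit = Any.tabulate⁻ {f = f} (cover n k)
         in n + f i , (f i , Equivalence.from (S⇔f (f i)) (i , refl) , refl) , hit
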